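{- Let $p$ be a fixed prime and let $\epsilon>0$ be a real number. Then, as functions of $r\in\mathbb{N}$, \[ v(p,p^r-1)=\begin{cases}\mathcal{O}\left(r^{(2+\epsilon)\ln(p)}\right) & \text{if } p>2,\\ \mathcal{O}\left(r^{2+\epsilon}\right) & \text{if } p=2.\end{cases} \]
   Context: Let $F$ be an algebraically closed field of characteristic $p>0$. For $k\in\mathbb{N}$, $v(p,k)$ denotes the smallest natural number $s$ such that every polynomial in $F[t]$ can be written as a sum of at most $s$ $k$-th powers of polynomials in $F[t]$ (with no restriction on the degrees of the polynomials being raised to the $k$-th power); if no such $s$ exists, $v(p,k)=\infty$. -}

module Defs where

open import Algebra.Apartness.Bundles using (HeytingField; HeytingCommutativeRing)
open import Algebra.Bundles using (CommutativeRing)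
import Algebra.Definitions.RawMonoid as RawMonoid
open import Axiom.ExcludedMiddle using (ExcludedMiddle)
open import Data.Empty using (⊥)
open import Data.Integer.Base as ℤ using (+_; -[1+_])
import Data.Integer.Properties as ℤ
open import Data.List.Base using (List; []; _∷_; foldr; length; map)
open import Data.Nat.Base as ℕ using (ℕ; zero; suc; z≤n; s≤s)
open import Data.Nat.Divisibility using (_∣_)
open import Data.Nat.Induction using (<-rec)
import Data.Nat.Properties as ℕ
open import Data.Product.Base using (∃-syntax; _×_; _,_; proj₁; proj₂)
open import Data.Rational.Base hiding (_⊔_)
open import Data.Rational.Properties
open import Data.Rational.Solver using (module +-*-Solver)
import Data.Rational.Unnormalised.Base as ℚᵘ
import Data.Rational.Unnormalised.Properties as ℚᵘ
open import Data.Sum.Base using (inj₁; inj₂)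
open import Function.Bundles using (_⇔_)
open import Level using (_⊔_)
open import Relation.Binary.PropositionalEquality
  using (_≡_; refl; sym; trans; cong; cong₂; subst; subst₂)
open import Relation.Nullary using (¬_; yes; no)

open import Algebra.Definitions.RawSemiring +-*-rawSemiring using (_^_)

open +-*-Solver using (solve; _:=_; _:+_; _:*_; _:-_; :-_; con)

private

  nn : ∀ {p} → 0ℚ ≤ p → NonNegative p
  nn = nonNegative

  *-monoˡ : ∀ {r p q} → 0ℚ ≤ r → p ≤ q → r * p ≤ r * q
  *-monoˡ {r} 0≤r = *-monoˡ-≤-nonNeg r {{nn 0≤r}}

  *-monoʳ : ∀ {r p q} → 0ℚ ≤ r → p ≤ q → p * r ≤ q * r
  *-monoʳ {r} 0≤r = *-monoʳ-≤-nonNeg r {{nn 0≤r}}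

  *-mono : ∀ {p q r s} → 0ℚ ≤ q → 0ℚ ≤ r → p ≤ q → r ≤ s → p * r ≤ q * s
  *-mono 0≤q 0≤r p≤q r≤s = ≤-trans (*-monoʳ 0≤r p≤q) (*-monoˡ 0≤q r≤s)

  0≤* : ∀ {p q} → 0ℚ ≤ p → 0ℚ ≤ q → 0ℚ ≤ p * q
  0≤* {p} {q} 0≤p 0≤q = subst (_≤ p * q) (*-zeroʳ p) (*-monoˡ 0≤p 0≤q)

  0≤+ : ∀ {p q} → 0ℚ ≤ p → 0ℚ ≤ q → 0ℚ ≤ p + q
  0≤+ = +-mono-≤

  p≤p+q : ∀ {p q} → 0ℚ ≤ q → p ≤ p + q
  p≤p+q {p} {q} 0≤q = subst (_≤ p + q) (+-identityʳ p) (+-monoʳ-≤ p 0≤q)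

  p≤q⇒0≤q-p : ∀ {p q} → p ≤ q → 0ℚ ≤ q - p
  p≤q⇒0≤q-p {p} {q} p≤q = subst (_≤ q - p) (+-inverseʳ p) (+-monoˡ-≤ (- p) p≤q)

  0≤q-p⇒p≤q : ∀ {p q} → 0ℚ ≤ q - p → p ≤ q
  0≤q-p⇒p≤q {p} {q} le = subst₂ _≤_ (+-identityˡ p) lem (+-monoˡ-≤ p le)
    where
    lem : q - p + p ≡ q
    lem = solve 2 (λ p q → q :- p :+ p := q) refl p q

  ∣-∣-sym : ∀ p q → ∣ p - q ∣ ≡ ∣ q - p ∣
  ∣-∣-sym p q = trans (sym (∣-p∣≡∣p∣ (p - q)))
    (cong ∣_∣ (solve 2 (λ p q → :- (p :- q) := q :- p) refl p q))

  p≤∣p∣ : ∀ p → p ≤ ∣ p ∣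
  p≤∣p∣ p with ≤-total 0ℚ p
  ... | inj₁ 0≤p = ≤-reflexive (sym (0≤p⇒∣p∣≡p 0≤p))
  ... | inj₂ p≤0 = ≤-trans p≤0 (0≤∣p∣ p)

  ∣-∣-tri : ∀ p q r → ∣ p - r ∣ ≤ ∣ p - q ∣ + ∣ q - r ∣
  ∣-∣-tri p q r = subst (λ t → ∣ t ∣ ≤ ∣ p - q ∣ + ∣ q - r ∣)
    (solve 3 (λ p q r → (p :- q) :+ (q :- r) := p :- r) refl p q r)
    (∣p+q∣≤∣p∣+∣q∣ (p - q) (q - r))

  ∣-∣-prod : ∀ a b c d → ∣ a * b - c * d ∣ ≤ ∣ a ∣ * ∣ b - d ∣ + ∣ a - c ∣ * ∣ d ∣
  ∣-∣-prod a b c d = begin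
    ∣ a * b - c * d ∣                    ≡⟨ cong ∣_∣ (solve 4 (λ a b c d →
                                             a :* b :- c :* d := a :* (b :- d) :+ (a :- c) :* d) refl a b c d) ⟩
    ∣ a * (b - d) + (a - c) * d ∣        ≤⟨ ∣p+q∣≤∣p∣+∣q∣ (a * (b - d)) ((a - c) * d) ⟩
    ∣ a * (b - d) ∣ + ∣ (a - c) * d ∣    ≡⟨ cong₂ _+_ (∣p*q∣≡∣p∣*∣q∣ a (b - d)) (∣p*q∣≡∣p∣*∣q∣ (a - c) d) ⟩
    ∣ a ∣ * ∣ b - d ∣ + ∣ a - c ∣ * ∣ d ∣   ∎
    where open ≤-Reasoning

  -- A copy of n ↦ + n / 1 that computes on successors.
  ι : ℕ → ℚ
  ι zero    = 0ℚ
  ι (suc n) = 1ℚ + ι n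

  ι≡ : ∀ n → ι n ≡ + n / 1
  ι≡ zero    = refl
  ι≡ (suc n) = trans (cong (λ t → 1ℚ + t) (ι≡ n)) (toℚᵘ-injective (begin
    toℚᵘ (1ℚ + (+ n / 1))            ≈⟨ toℚᵘ-homo-+ 1ℚ (+ n / 1) ⟩
    ℚᵘ.1ℚᵘ ℚᵘ.+ toℚᵘ (+ n / 1)       ≈⟨ ℚᵘ.+-congʳ ℚᵘ.1ℚᵘ (toℚᵘ-fromℚᵘ (ℚᵘ.mkℚᵘ (+ n) 0)) ⟩
    ℚᵘ.1ℚᵘ ℚᵘ.+ ℚᵘ.mkℚᵘ (+ n) 0      ≈⟨ ℚᵘ.*≡* (cong (λ t → (+ 1 ℤ.+ t) ℤ.* + 1) (ℤ.*-identityʳ (+ n))) ⟩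
    ℚᵘ.mkℚᵘ (+ suc n) 0              ≈⟨ ℚᵘ.≃-sym (toℚᵘ-fromℚᵘ (ℚᵘ.mkℚᵘ (+ suc n) 0)) ⟩
    toℚᵘ (+ suc n / 1)               ∎))
    where open ℚᵘ.≃-Reasoning

  ι*1/ : ∀ i → ι (suc i) * (+ 1 / suc i) ≡ 1ℚ
  ι*1/ i = trans (cong (_* (+ 1 / suc i)) (ι≡ (suc i))) (toℚᵘ-injective (begin
    toℚᵘ ((+ suc i / 1) * (+ 1 / suc i))                 ≈⟨ toℚᵘ-homo-* (+ suc i / 1) (+ 1 / suc i) ⟩
    toℚᵘ (+ suc i / 1) ℚᵘ.* toℚᵘ (+ 1 / suc i)           ≈⟨ ℚᵘ.*-cong (toℚᵘ-fromℚᵘ (ℚᵘ.mkℚᵘ (+ suc i) 0))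
                                                                       (toℚᵘ-fromℚᵘ (ℚᵘ.mkℚᵘ (+ 1) i)) ⟩
    ℚᵘ.mkℚᵘ (+ suc i) 0 ℚᵘ.* ℚᵘ.mkℚᵘ (+ 1) i             ≈⟨ ℚᵘ.*≡* (trans (ℤ.*-identityʳ _)
                                                              (trans (ℤ.*-identityʳ (+ suc i))
                                                              (sym (trans (ℤ.*-identityˡ _)
                                                                (cong (λ t → + suc t) (ℕ.+-identityʳ i)))))) ⟩
    ℚᵘ.1ℚᵘ                                               ∎))
    where open ℚᵘ.≃-Reasoning

  0≤ι : ∀ n → 0ℚ ≤ ι n
  0≤ι zero    = ≤-refl
  0≤ι (suc n) = 0≤+ {1ℚ} (nonNegative⁻¹ 1ℚ) (0≤ι n)

  0<ι : ∀ n → 0ℚ < ι (suc n)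
  0<ι n = +-mono-<-≤ (positive⁻¹ 1ℚ) (0≤ι n)

  ι-mono : ∀ {m n} → m ℕ.≤ n → ι m ≤ ι n
  ι-mono {n = n} z≤n   = 0≤ι n
  ι-mono (s≤s m≤n) = +-monoʳ-≤ 1ℚ (ι-mono m≤n)

  0≤1/ : ∀ i → 0ℚ ≤ + 1 / suc i
  0≤1/ i = nonNegative⁻¹ (+ 1 / suc i) {{normalize-nonNeg 1 (suc i)}}

  archimedean : ∀ q → ∃[ n ] q ≤ ι n
  archimedean q@(mkℚ (+ n) d-1 _) =
    n , subst (q ≤_) (sym (ι≡ n)) (toℚᵘ-cancel-≤ (ℚᵘ.≤-respʳ-≃ (ℚᵘ.≃-sym (toℚᵘ-fromℚᵘ (ℚᵘ.mkℚᵘ (+ n) 0)))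
      (ℚᵘ.*≤* (ℤ.*-monoˡ-≤-nonNeg (+ n) (ℤ.+≤+ (s≤s z≤n))))))
  archimedean q@(mkℚ -[1+ _ ] _ _) = 0 , nonPositive⁻¹ q

IsCauchy : (ℕ → ℚ) → Set
IsCauchy x = ∀ δ → 0ℚ < δ → ∃[ N ] ∀ m n → N ℕ.≤ m → N ℕ.≤ n → ∣ x m - x n ∣ ≤ δ

record ℝ : Set where
  constructor mkℝ
  field
    seq    : ℕ → ℚ
    cauchy : IsCauchy seq

open ℝ public

infix 4 _≤ᵣ_ _<ᵣ_

_≤ᵣ_ : ℝ → ℝ → Set
x ≤ᵣ y = ∀ δ → 0ℚ < δ → ∃[ N ] ∀ n → N ℕ.≤ n → seq x n ≤ seq y n + δ

_<ᵣ_ : ℝ → ℝ → Set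
x <ᵣ y = ∃[ δ ] 0ℚ < δ × ∃[ N ] ∀ n → N ℕ.≤ n → seq x n + δ ≤ seq y n

private

  tail⇒cauchy : ∀ x K → 0ℚ < K →
    (∀ δ → 0ℚ < δ → ∃[ N ] ∀ n → N ℕ.≤ n → ∣ x n - x N ∣ ≤ K * δ) → IsCauchy x
  tail⇒cauchy x K 0<K tail δ 0<δ = N , bound
    where
    instance
      pos2K : Positive (K + K)
      pos2K = positive (+-mono-< 0<K 0<K)
      nz2K : NonZero (K + K)
      nz2K = pos⇒nonZero (K + K)

    δ' : ℚ
    δ' = δ * 1/ (K + K)

    0<δ' : 0ℚ < δ'
    0<δ' = positive⁻¹ δ' {{pos*pos⇒pos δ {{positive 0<δ}} (1/ (K + K)) {{1/pos⇒pos (K + K)}}}}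

    N : ℕ
    N = proj₁ (tail δ' 0<δ')

    eq : K * δ' + K * δ' ≡ δ
    eq = trans (solve 3 (λ k d i → k :* (d :* i) :+ k :* (d :* i) := d :* ((k :+ k) :* i)) refl
                 K δ (1/ (K + K)))
        (trans (cong (δ *_) (*-inverseʳ (K + K))) (*-identityʳ δ))

    bound : ∀ m n → N ℕ.≤ m → N ℕ.≤ n → ∣ x m - x n ∣ ≤ δ
    bound m n N≤m N≤n = begin
      ∣ x m - x n ∣                   ≤⟨ ∣-∣-tri (x m) (x N) (x n) ⟩
      ∣ x m - x N ∣ + ∣ x N - x n ∣   ≡⟨ cong (λ t → ∣ x m - x N ∣ + t) (∣-∣-sym (x N) (x n)) ⟩
      ∣ x m - x N ∣ + ∣ x n - x N ∣   ≤⟨ +-mono-≤ (proj₂ (tail δ' 0<δ') m N≤m) (proj₂ (tail δ' 0<δ') n N≤n) ⟩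
      K * δ' + K * δ'                 ≡⟨ eq ⟩
      δ                               ∎
      where open ≤-Reasoning

  Bound : (ℕ → ℚ) → Set
  Bound x = ∃[ B ] 0ℚ < B × ∃[ N ] ∀ n → N ℕ.≤ n → ∣ x n ∣ ≤ B

  bounded : ∀ x → IsCauchy x → Bound x
  bounded x cx = 1ℚ + ∣ x N ∣ , +-mono-<-≤ (positive⁻¹ 1ℚ) (0≤∣p∣ (x N)) , N , bound
    where
    N = proj₁ (cx 1ℚ (positive⁻¹ 1ℚ))
    near = proj₂ (cx 1ℚ (positive⁻¹ 1ℚ))
    bound : ∀ n → N ℕ.≤ n → ∣ x n ∣ ≤ 1ℚ + ∣ x N ∣
    bound n N≤n = begin
      ∣ x n ∣                   ≡⟨ cong ∣_∣ (solve 2 (λ a b → a := (a :- b) :+ b) refl (x n) (x N)) ⟩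
      ∣ x n - x N + x N ∣       ≤⟨ ∣p+q∣≤∣p∣+∣q∣ (x n - x N) (x N) ⟩
      ∣ x n - x N ∣ + ∣ x N ∣   ≤⟨ +-monoˡ-≤ ∣ x N ∣ (near n N N≤n ℕ.≤-refl) ⟩
      1ℚ + ∣ x N ∣              ∎
      where open ≤-Reasoning

  +-cauchy : ∀ x y → IsCauchy x → IsCauchy y → IsCauchy (λ n → x n + y n)
  +-cauchy x y cx cy = tail⇒cauchy (λ n → x n + y n) (1ℚ + 1ℚ) (positive⁻¹ (1ℚ + 1ℚ)) tail
    where
    tail : ∀ δ → 0ℚ < δ → ∃[ N ] ∀ n → N ℕ.≤ n →
           ∣ (x n + y n) - (x N + y N) ∣ ≤ (1ℚ + 1ℚ) * δ
    tail δ 0<δ = N , λ n N≤n → begin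
      ∣ (x n + y n) - (x N + y N) ∣   ≡⟨ cong ∣_∣ (solve 4 (λ a b c d →
                                           (a :+ b) :- (c :+ d) := (a :- c) :+ (b :- d)) refl
                                           (x n) (y n) (x N) (y N)) ⟩
      ∣ (x n - x N) + (y n - y N) ∣   ≤⟨ ∣p+q∣≤∣p∣+∣q∣ (x n - x N) (y n - y N) ⟩
      ∣ x n - x N ∣ + ∣ y n - y N ∣   ≤⟨ +-mono-≤ (hx n N (ℕ.≤-trans N₁≤N N≤n) N₁≤N)
                                                  (hy n N (ℕ.≤-trans N₂≤N N≤n) N₂≤N) ⟩
      δ + δ                           ≡⟨ solve 1 (λ d → d :+ d := (con 1ℚ :+ con 1ℚ) :* d) refl δ ⟩
      (1ℚ + 1ℚ) * δ                   ∎
      where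
      open ≤-Reasoning
      N₁ = proj₁ (cx δ 0<δ)
      N₂ = proj₁ (cy δ 0<δ)
      hx = proj₂ (cx δ 0<δ)
      hy = proj₂ (cy δ 0<δ)
      N = N₁ ℕ.⊔ N₂
      N₁≤N = ℕ.m≤m⊔n N₁ N₂
      N₂≤N = ℕ.m≤n⊔m N₁ N₂

  *-cauchy : ∀ x y → IsCauchy x → IsCauchy y → IsCauchy (λ n → x n * y n)
  *-cauchy x y cx cy = bounds⇒cauchy (bounded x cx) (bounded y cy)
    where
    bounds⇒cauchy : Bound x → Bound y → IsCauchy (λ n → x n * y n)
    bounds⇒cauchy (A , 0<A , Nx , bx) (B , 0<B , Ny , by) =
      tail⇒cauchy (λ n → x n * y n) (A + B) (+-mono-< 0<A 0<B) tail
      where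
      tail : ∀ δ → 0ℚ < δ → ∃[ N ] ∀ n → N ℕ.≤ n →
             ∣ x n * y n - x N * y N ∣ ≤ (A + B) * δ
      tail δ 0<δ = N , λ n N≤n → begin
        ∣ x n * y n - x N * y N ∣                       ≤⟨ ∣-∣-prod (x n) (y n) (x N) (y N) ⟩
        ∣ x n ∣ * ∣ y n - y N ∣ + ∣ x n - x N ∣ * ∣ y N ∣
          ≤⟨ +-mono-≤
               (*-mono (<⇒≤ 0<A) (0≤∣p∣ (y n - y N)) (bx n (ℕ.≤-trans Nx≤N N≤n)) (hy n N (ℕ.≤-trans N₂≤N N≤n) N₂≤N))
               (*-mono (<⇒≤ 0<δ) (0≤∣p∣ (y N)) (hx n N (ℕ.≤-trans N₁≤N N≤n) N₁≤N) (by N Ny≤N)) ⟩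
        A * δ + δ * B                                   ≡⟨ solve 3 (λ a b d → a :* d :+ d :* b := (a :+ b) :* d)
                                                             refl A B δ ⟩
        (A + B) * δ                                     ∎
        where
        open ≤-Reasoning
        N₁ = proj₁ (cx δ 0<δ)
        N₂ = proj₁ (cy δ 0<δ)
        hx = proj₂ (cx δ 0<δ)
        hy = proj₂ (cy δ 0<δ)
        N = (N₁ ℕ.⊔ N₂) ℕ.⊔ (Nx ℕ.⊔ Ny)
        N₁≤N = ℕ.≤-trans (ℕ.m≤m⊔n N₁ N₂) (ℕ.m≤m⊔n _ (Nx ℕ.⊔ Ny))
        N₂≤N = ℕ.≤-trans (ℕ.m≤n⊔m N₁ N₂) (ℕ.m≤m⊔n _ (Nx ℕ.⊔ Ny))
        Nx≤N = ℕ.≤-trans (ℕ.m≤m⊔n Nx Ny) (ℕ.m≤n⊔m (N₁ ℕ.⊔ N₂) _)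
        Ny≤N = ℕ.≤-trans (ℕ.m≤n⊔m Nx Ny) (ℕ.m≤n⊔m (N₁ ℕ.⊔ N₂) _)

fromℚ : ℚ → ℝ
fromℚ q = mkℝ (λ _ → q) λ δ 0<δ →
  0 , λ _ _ _ _ → subst (λ t → ∣ t ∣ ≤ δ) (sym (+-inverseʳ q)) (<⇒≤ 0<δ)

fromℕ : ℕ → ℝ
fromℕ n = fromℚ (+ n / 1)

infixl 6 _+ᵣ_
infixl 7 _*ᵣ_

_+ᵣ_ : ℝ → ℝ → ℝ
x +ᵣ y = mkℝ (λ n → seq x n + seq y n) (+-cauchy (seq x) (seq y) (cauchy x) (cauchy y))

_*ᵣ_ : ℝ → ℝ → ℝ
x *ᵣ y = mkℝ (λ n → seq x n * seq y n) (*-cauchy (seq x) (seq y) (cauchy x) (cauchy y))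

∑ : (ℕ → ℚ) → ℕ → ℚ
∑ a zero    = 0ℚ
∑ a (suc n) = ∑ a n + a n

private

  -- The hypothesis on a is the ratio test a (suc i) ≤ (1 - 1 / K) * a i,
  -- in a form that telescopes.
  module Ratio (a : ℕ → ℚ) (0≤a : ∀ i → 0ℚ ≤ a i) (K : ℚ) (0<K : 0ℚ < K) (J : ℕ)
               (ratio : ∀ i → J ℕ.≤ i → a i ≤ K * (a i - a (suc i))) where

    open ≤-Reasoning

    telescope : ∀ N d → J ℕ.≤ N → ∑ a (d ℕ.+ N) - ∑ a N ≤ K * (a N - a (d ℕ.+ N))
    telescope N zero    J≤N = ≤-reflexive (solve 3 (λ s k t → s :- s := k :* (t :- t)) refl (∑ a N) K (a N))
    telescope N (suc d) J≤N = begin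
      (S' + a i) - S                                ≡⟨ solve 3 (λ s' t s → (s' :+ t) :- s := (s' :- s) :+ t) refl S' (a i) S ⟩
      (S' - S) + a i                                ≤⟨ +-mono-≤ (telescope N d J≤N) (ratio i (ℕ.≤-trans J≤N (ℕ.m≤n+m N d))) ⟩
      K * (a N - a i) + K * (a i - a (suc i))       ≡⟨ solve 4 (λ k x y z → k :* (x :- y) :+ k :* (y :- z) := k :* (x :- z))
                                                         refl K (a N) (a i) (a (suc i)) ⟩
      K * (a N - a (suc i))                         ∎
      where
      i = d ℕ.+ N
      S' = ∑ a i
      S = ∑ a N

    telescope′ : ∀ N d → J ℕ.≤ N → ∑ a (d ℕ.+ N) - ∑ a N ≤ K * a N
    telescope′ N d J≤N = ≤-trans (telescope N d J≤N) (*-monoˡ (<⇒≤ 0<K) (begin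
      a N - a (d ℕ.+ N)                   ≤⟨ p≤p+q (0≤a (d ℕ.+ N)) ⟩
      a N - a (d ℕ.+ N) + a (d ℕ.+ N)     ≡⟨ solve 2 (λ x y → x :- y :+ y := x) refl (a N) (a (d ℕ.+ N)) ⟩
      a N                                 ∎))

    decreasing : ∀ i → J ℕ.≤ i → a (suc i) ≤ a i
    decreasing i J≤i = 0≤q-p⇒p≤q (*-cancelˡ-≤-pos K {{positive 0<K}}
      (subst (_≤ K * (a i - a (suc i))) (sym (*-zeroʳ K)) (≤-trans (0≤a i) (ratio i J≤i))))

    d*a≤∑ : ∀ d → ι d * a (d ℕ.+ J) ≤ ∑ a (d ℕ.+ J) - ∑ a J
    d*a≤∑ zero    = ≤-reflexive (trans (*-zeroˡ (a J)) (sym (+-inverseʳ (∑ a J))))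
    d*a≤∑ (suc d) = begin
      ι (suc d) * a (suc i)         ≤⟨ *-monoˡ (0≤ι (suc d)) (decreasing i (ℕ.m≤n+m J d)) ⟩
      (1ℚ + ι d) * a i              ≡⟨ solve 2 (λ x y → (con 1ℚ :+ x) :* y := x :* y :+ y) refl (ι d) (a i) ⟩
      ι d * a i + a i               ≤⟨ +-monoˡ-≤ (a i) (d*a≤∑ d) ⟩
      (∑ a i - ∑ a J) + a i         ≡⟨ solve 3 (λ s' t s → (s' :- s) :+ t := (s' :+ t) :- s) refl (∑ a i) (a i) (∑ a J) ⟩
      ∑ a (suc i) - ∑ a J           ∎
      where i = d ℕ.+ J

    small : ∀ δ → 0ℚ < δ → ∃[ N ] J ℕ.≤ N × a N ≤ δ
    small δ 0<δ = N , ℕ.m≤n+m J d , *-cancelˡ-≤-pos (ι d) {{positive (0<ι n)}} (begin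
      ι d * a N          ≤⟨ d*a≤∑ d ⟩
      ∑ a N - ∑ a J      ≤⟨ telescope′ J d ℕ.≤-refl ⟩
      K * a J            ≡⟨ sym (trans (*-assoc (K * a J) (1/ δ) δ)
                              (trans (cong (K * a J *_) (*-inverseˡ δ)) (*-identityʳ (K * a J)))) ⟩
      K * a J * 1/ δ * δ ≤⟨ *-monoʳ (<⇒≤ 0<δ) (≤-trans (proj₂ (archimedean (K * a J * 1/ δ)))
                                                        (ι-mono (ℕ.n≤1+n n))) ⟩
      ι d * δ            ∎)
      where
      instance
        δ≢0 : NonZero δ
        δ≢0 = pos⇒nonZero δ {{positive 0<δ}}
      n = proj₁ (archimedean (K * a J * 1/ δ))
      d = suc n
      N = d ℕ.+ J

    ∑-mono : ∀ N d → ∑ a N ≤ ∑ a (d ℕ.+ N)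
    ∑-mono N zero    = ≤-refl
    ∑-mono N (suc d) = ≤-trans (∑-mono N d) (p≤p+q (0≤a (d ℕ.+ N)))

    ∑-cauchy : IsCauchy (∑ a)
    ∑-cauchy = tail⇒cauchy (∑ a) K 0<K λ δ 0<δ →
      let N , J≤N , aN≤δ = small δ 0<δ in
      N , λ n N≤n → subst (λ m → ∣ ∑ a m - ∑ a N ∣ ≤ K * δ) (ℕ.m∸n+n≡m N≤n) (begin
        ∣ ∑ a (n ℕ.∸ N ℕ.+ N) - ∑ a N ∣   ≡⟨ 0≤p⇒∣p∣≡p (p≤q⇒0≤q-p (∑-mono N (n ℕ.∸ N))) ⟩
        ∑ a (n ℕ.∸ N ℕ.+ N) - ∑ a N       ≤⟨ telescope′ N (n ℕ.∸ N) J≤N ⟩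
        K * a N                           ≤⟨ *-monoˡ (<⇒≤ 0<K) aN≤δ ⟩
        K * δ                             ∎)

-- expTerm x i is xⁱ / i!
expTerm : ℚ → ℕ → ℚ
expTerm x zero    = 1ℚ
expTerm x (suc i) = expTerm x i * (x * (+ 1 / suc i))

private
  module Exp where

    open ≤-Reasoning

    0≤term : ∀ {M} → 0ℚ ≤ M → ∀ i → 0ℚ ≤ expTerm M i
    0≤term 0≤M zero    = nonNegative⁻¹ 1ℚ
    0≤term 0≤M (suc i) = 0≤* (0≤term 0≤M i) (0≤* 0≤M (0≤1/ i))

    ∑-cauchy : ∀ {M} → 0ℚ ≤ M → IsCauchy (∑ (expTerm M))
    ∑-cauchy {M} 0≤M = Ratio.∑-cauchy (expTerm M) (0≤term 0≤M) (1ℚ + 1ℚ) (positive⁻¹ (1ℚ + 1ℚ)) J ratio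
      where
      J = proj₁ (archimedean (M + M))
      ratio : ∀ i → J ℕ.≤ i → expTerm M i ≤ (1ℚ + 1ℚ) * (expTerm M i - expTerm M (suc i))
      ratio i J≤i = 0≤q-p⇒p≤q (subst (0ℚ ≤_) eq (0≤* (0≤term 0≤M i) (p≤q⇒0≤q-p le)))
        where
        le : (M + M) * (+ 1 / suc i) ≤ 1ℚ
        le = begin
          (M + M) * (+ 1 / suc i)     ≤⟨ *-monoʳ (0≤1/ i) (≤-trans (proj₂ (archimedean (M + M)))
                                                              (ι-mono (ℕ.≤-trans J≤i (ℕ.n≤1+n i)))) ⟩
          ι (suc i) * (+ 1 / suc i)   ≡⟨ ι*1/ i ⟩
          1ℚ                          ∎
        eq : expTerm M i * (1ℚ - (M + M) * (+ 1 / suc i)) ≡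
             (1ℚ + 1ℚ) * (expTerm M i - expTerm M (suc i)) - expTerm M i
        eq = solve 3 (λ t m u → t :* (con 1ℚ :- (m :+ m) :* u) :=
               (con 1ℚ :+ con 1ℚ) :* (t :- t :* (m :* u)) :- t) refl (expTerm M i) M (+ 1 / suc i)

    ∣1/∣ : ∀ i → ∣ + 1 / suc i ∣ ≡ + 1 / suc i
    ∣1/∣ i = 0≤p⇒∣p∣≡p (0≤1/ i)

    module _ {M : ℚ} (0≤M : 0ℚ ≤ M) where

      ∣term∣≤ : ∀ x → ∣ x ∣ ≤ M → ∀ i → ∣ expTerm x i ∣ ≤ expTerm M i
      ∣term∣≤ x x≤M zero    = ≤-refl
      ∣term∣≤ x x≤M (suc i) = begin
        ∣ expTerm x i * (x * u) ∣       ≡⟨ ∣p*q∣≡∣p∣*∣q∣ (expTerm x i) (x * u) ⟩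
        ∣ expTerm x i ∣ * ∣ x * u ∣     ≤⟨ *-mono (0≤term 0≤M i) (0≤∣p∣ (x * u)) (∣term∣≤ x x≤M i) (begin
          ∣ x * u ∣                         ≡⟨ ∣p*q∣≡∣p∣*∣q∣ x u ⟩
          ∣ x ∣ * ∣ u ∣                     ≡⟨ cong (∣ x ∣ *_) (∣1/∣ i) ⟩
          ∣ x ∣ * u                         ≤⟨ *-monoʳ (0≤1/ i) x≤M ⟩
          M * u                             ∎) ⟩
        expTerm M i * (M * u)           ∎
        where u = + 1 / suc i

      term-lipschitz : ∀ x y → ∣ x ∣ ≤ M → ∣ y ∣ ≤ M → ∀ i →
        ∣ expTerm x (suc i) - expTerm y (suc i) ∣ ≤ ∣ x - y ∣ * expTerm M i
      term-lipschitz x y x≤M y≤M i = begin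
        ∣ expTerm x i * (x * u) - expTerm y i * (y * u) ∣
          ≡⟨ cong ∣_∣ (solve 5 (λ s t x y u → s :* (x :* u) :- t :* (y :* u) :=
               (s :* (x :- y) :+ y :* (s :- t)) :* u) refl (expTerm x i) (expTerm y i) x y u) ⟩
        ∣ (expTerm x i * (x - y) + y * D) * u ∣
          ≡⟨ ∣p*q∣≡∣p∣*∣q∣ (expTerm x i * (x - y) + y * D) u ⟩
        ∣ expTerm x i * (x - y) + y * D ∣ * ∣ u ∣
          ≡⟨ cong (∣ expTerm x i * (x - y) + y * D ∣ *_) (∣1/∣ i) ⟩
        ∣ expTerm x i * (x - y) + y * D ∣ * u
          ≤⟨ *-monoʳ (0≤1/ i) (∣p+q∣≤∣p∣+∣q∣ (expTerm x i * (x - y)) (y * D)) ⟩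
        (∣ expTerm x i * (x - y) ∣ + ∣ y * D ∣) * u
          ≡⟨ cong₂ (λ p q → (p + q) * u) (∣p*q∣≡∣p∣*∣q∣ (expTerm x i) (x - y)) (∣p*q∣≡∣p∣*∣q∣ y D) ⟩
        (∣ expTerm x i ∣ * h + ∣ y ∣ * ∣ D ∣) * u
          ≤⟨ *-monoʳ (0≤1/ i) (+-mono-≤ (*-monoʳ (0≤∣p∣ (x - y)) (∣term∣≤ x x≤M i))
                                        (*-monoʳ (0≤∣p∣ D) y≤M)) ⟩
        (T * h + M * ∣ D ∣) * u
          ≤⟨ *-monoʳ (0≤1/ i) (+-monoʳ-≤ (T * h) (step i)) ⟩
        (T * h + ι i * (h * T)) * u
          ≡⟨ solve 4 (λ t h n u → (t :* h :+ n :* (h :* t)) :* u := h :* t :* ((con 1ℚ :+ n) :* u))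
               refl T h (ι i) u ⟩
        h * T * (ι (suc i) * u)
          ≡⟨ trans (cong (h * T *_) (ι*1/ i)) (*-identityʳ (h * T)) ⟩
        h * T ∎
        where
        u = + 1 / suc i
        D = expTerm x i - expTerm y i
        T = expTerm M i
        h = ∣ x - y ∣
        step : ∀ i → M * ∣ expTerm x i - expTerm y i ∣ ≤ ι i * (h * expTerm M i)
        step zero    = ≤-reflexive (trans (*-zeroʳ M) (sym (*-zeroˡ (h * 1ℚ))))
        step (suc j) = begin
          M * ∣ expTerm x (suc j) - expTerm y (suc j) ∣
            ≤⟨ *-monoˡ 0≤M (term-lipschitz x y x≤M y≤M j) ⟩
          M * (h * expTerm M j)
            ≡⟨ sym (trans (cong (M * (h * expTerm M j) *_) (ι*1/ j)) (*-identityʳ _)) ⟩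
          M * (h * expTerm M j) * (ι (suc j) * (+ 1 / suc j))
            ≡⟨ solve 5 (λ m h t n u → m :* (h :* t) :* (n :* u) := n :* (h :* (t :* (m :* u)))) refl
                 M h (expTerm M j) (ι (suc j)) (+ 1 / suc j) ⟩
          ι (suc j) * (h * expTerm M (suc j)) ∎

      ∑-lipschitz : ∀ x y → ∣ x ∣ ≤ M → ∣ y ∣ ≤ M → ∀ n →
        ∣ ∑ (expTerm x) n - ∑ (expTerm y) n ∣ ≤ ∣ x - y ∣ * ∑ (expTerm M) n
      ∑-lipschitz x y x≤M y≤M n = ≤-trans (shifted n)
        (*-monoˡ (0≤∣p∣ (x - y)) (pred-mono n))
        where
        pred-mono : ∀ n → ∑ (expTerm M) (ℕ.pred n) ≤ ∑ (expTerm M) n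
        pred-mono zero    = ≤-refl
        pred-mono (suc n) = p≤p+q (0≤term 0≤M n)
        shifted : ∀ n → ∣ ∑ (expTerm x) n - ∑ (expTerm y) n ∣ ≤ ∣ x - y ∣ * ∑ (expTerm M) (ℕ.pred n)
        shifted zero          = ≤-reflexive (sym (*-zeroʳ ∣ x - y ∣))
        shifted (suc zero)    = ≤-reflexive (sym (*-zeroʳ ∣ x - y ∣))
        shifted (suc (suc n)) = begin
          ∣ (X + s) - (Y + t) ∣                    ≡⟨ cong ∣_∣ (solve 4 (λ X s Y t → (X :+ s) :- (Y :+ t) :=
                                                        (X :- Y) :+ (s :- t)) refl X s Y t) ⟩
          ∣ (X - Y) + (s - t) ∣                    ≤⟨ ∣p+q∣≤∣p∣+∣q∣ (X - Y) (s - t) ⟩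
          ∣ X - Y ∣ + ∣ s - t ∣                    ≤⟨ +-mono-≤ (shifted (suc n)) (term-lipschitz x y x≤M y≤M n) ⟩
          ∣ x - y ∣ * ∑ (expTerm M) n + ∣ x - y ∣ * expTerm M n
                                                   ≡⟨ sym (*-distribˡ-+ ∣ x - y ∣ (∑ (expTerm M) n) (expTerm M n)) ⟩
          ∣ x - y ∣ * ∑ (expTerm M) (suc n)        ∎
          where
          X = ∑ (expTerm x) (suc n)
          Y = ∑ (expTerm y) (suc n)
          s = expTerm x (suc n)
          t = expTerm y (suc n)

      ∑-tail : ∀ x → ∣ x ∣ ≤ M → ∀ N d →
        ∣ ∑ (expTerm x) (d ℕ.+ N) - ∑ (expTerm x) N ∣ ≤ ∑ (expTerm M) (d ℕ.+ N) - ∑ (expTerm M) N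
      ∑-tail x x≤M N zero    = ≤-reflexive (trans (cong ∣_∣ (+-inverseʳ (∑ (expTerm x) N)))
                                                  (sym (+-inverseʳ (∑ (expTerm M) N))))
      ∑-tail x x≤M N (suc d) = begin
        ∣ (S' + t) - S ∣         ≡⟨ cong ∣_∣ (solve 3 (λ a t b → (a :+ t) :- b := (a :- b) :+ t) refl S' t S) ⟩
        ∣ (S' - S) + t ∣         ≤⟨ ∣p+q∣≤∣p∣+∣q∣ (S' - S) t ⟩
        ∣ S' - S ∣ + ∣ t ∣       ≤⟨ +-mono-≤ (∑-tail x x≤M N d) (∣term∣≤ x x≤M (d ℕ.+ N)) ⟩
        (R' - R) + T             ≡⟨ solve 3 (λ a t b → (a :- b) :+ t := (a :+ t) :- b) refl R' T R ⟩
        (R' + T) - R             ∎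
        where
        S' = ∑ (expTerm x) (d ℕ.+ N)
        S  = ∑ (expTerm x) N
        t  = expTerm x (d ℕ.+ N)
        R' = ∑ (expTerm M) (d ℕ.+ N)
        R  = ∑ (expTerm M) N
        T  = expTerm M (d ℕ.+ N)

    exp-cauchy : ∀ x → IsCauchy x → IsCauchy (λ n → ∑ (expTerm (x n)) n)
    exp-cauchy x cx = bound⇒cauchy (bounded x cx)
      where
      bound⇒cauchy : Bound x → IsCauchy (λ n → ∑ (expTerm (x n)) n)
      bound⇒cauchy (M , 0<M , N₀ , x≤M) =
        tail⇒cauchy (λ n → ∑ (expTerm (x n)) n) (B + 1ℚ) (+-mono-< 0<B (positive⁻¹ 1ℚ)) tail
        where
        0≤M = <⇒≤ 0<M
        E : Bound (∑ (expTerm M))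
        E = bounded (∑ (expTerm M)) (∑-cauchy 0≤M)
        B = proj₁ E
        0<B = proj₁ (proj₂ E)
        N₁ = proj₁ (proj₂ (proj₂ E))
        E≤B = proj₂ (proj₂ (proj₂ E))
        tail : ∀ δ → 0ℚ < δ → ∃[ N ] ∀ n → N ℕ.≤ n →
               ∣ ∑ (expTerm (x n)) n - ∑ (expTerm (x N)) N ∣ ≤ (B + 1ℚ) * δ
        tail δ 0<δ = N , bound
          where
          N₂ = proj₁ (cx δ 0<δ)
          hx = proj₂ (cx δ 0<δ)
          N₃ = proj₁ (∑-cauchy 0≤M δ 0<δ)
          hE = proj₂ (∑-cauchy 0≤M δ 0<δ)
          N = (N₀ ℕ.⊔ N₁) ℕ.⊔ (N₂ ℕ.⊔ N₃)
          N₀≤N = ℕ.≤-trans (ℕ.m≤m⊔n N₀ N₁) (ℕ.m≤m⊔n _ (N₂ ℕ.⊔ N₃))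
          N₁≤N = ℕ.≤-trans (ℕ.m≤n⊔m N₀ N₁) (ℕ.m≤m⊔n _ (N₂ ℕ.⊔ N₃))
          N₂≤N = ℕ.≤-trans (ℕ.m≤m⊔n N₂ N₃) (ℕ.m≤n⊔m (N₀ ℕ.⊔ N₁) _)
          N₃≤N = ℕ.≤-trans (ℕ.m≤n⊔m N₂ N₃) (ℕ.m≤n⊔m (N₀ ℕ.⊔ N₁) _)
          bound : ∀ n → N ℕ.≤ n → ∣ ∑ (expTerm (x n)) n - ∑ (expTerm (x N)) N ∣ ≤ (B + 1ℚ) * δ
          bound n N≤n = begin
            ∣ ∑ (expTerm (x n)) n - ∑ (expTerm (x N)) N ∣
              ≤⟨ ∣-∣-tri (∑ (expTerm (x n)) n) (∑ (expTerm (x N)) n) (∑ (expTerm (x N)) N) ⟩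
            ∣ ∑ (expTerm (x n)) n - ∑ (expTerm (x N)) n ∣ + ∣ ∑ (expTerm (x N)) n - ∑ (expTerm (x N)) N ∣
              ≤⟨ +-mono-≤ (≤-trans (∑-lipschitz 0≤M (x n) (x N) xn≤M xN≤M n) near) far ⟩
            δ * B + δ
              ≡⟨ solve 2 (λ d b → d :* b :+ d := (b :+ con 1ℚ) :* d) refl δ B ⟩
            (B + 1ℚ) * δ ∎
            where
            xn≤M = x≤M n (ℕ.≤-trans N₀≤N N≤n)
            xN≤M = x≤M N N₀≤N
            near : ∣ x n - x N ∣ * ∑ (expTerm M) n ≤ δ * B
            near = ≤-trans
              (*-monoˡ (0≤∣p∣ (x n - x N)) (≤-trans (p≤∣p∣ (∑ (expTerm M) n)) (E≤B n (ℕ.≤-trans N₁≤N N≤n))))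
              (*-monoʳ (<⇒≤ 0<B) (hx n N (ℕ.≤-trans N₂≤N N≤n) N₂≤N))
            far : ∣ ∑ (expTerm (x N)) n - ∑ (expTerm (x N)) N ∣ ≤ δ
            far = subst (λ m → ∣ ∑ (expTerm (x N)) m - ∑ (expTerm (x N)) N ∣ ≤ δ) (ℕ.m∸n+n≡m N≤n)
              (≤-trans (∑-tail 0≤M (x N) xN≤M N (n ℕ.∸ N))
              (≤-trans (p≤∣p∣ (∑ (expTerm M) (n ℕ.∸ N ℕ.+ N) - ∑ (expTerm M) N))
              (hE (n ℕ.∸ N ℕ.+ N) N (ℕ.≤-trans N₃≤N (ℕ.m≤n+m N (n ℕ.∸ N))) N₃≤N)))

exp : ℝ → ℝ
exp x = mkℝ (λ n → ∑ (expTerm (seq x n)) n) (Exp.exp-cauchy (seq x) (cauchy x))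

-- The Mercator series: with y = 1 - 1 / (n + 1),
-- ln (n + 1) = - ln (1 - y) = ∑ᵢ yⁱ⁺¹ / (i + 1).
lnTerm : ℕ → ℕ → ℚ
lnTerm n i = (1ℚ - + 1 / suc n) ^ suc i * (+ 1 / suc i)

private
  module Ln (n : ℕ) where

    open ≤-Reasoning

    u y K : ℚ
    u = + 1 / suc n
    y = 1ℚ - u
    K = ι (suc n)

    0≤y : 0ℚ ≤ y
    0≤y = subst (0ℚ ≤_) eq (0≤* (0≤ι n) (0≤1/ n))
      where
      eq : ι n * u ≡ 1ℚ - u
      eq = trans (solve 2 (λ m u → m :* u := (con 1ℚ :+ m) :* u :- u) refl (ι n) u)
                 (cong (_- u) (ι*1/ n))

    0≤y^ : ∀ i → 0ℚ ≤ y ^ i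
    0≤y^ zero    = nonNegative⁻¹ 1ℚ
    0≤y^ (suc i) = 0≤* 0≤y (0≤y^ i)

    1/-decreasing : ∀ i → + 1 / suc (suc i) ≤ + 1 / suc i
    1/-decreasing i = 0≤q-p⇒p≤q (subst (0ℚ ≤_) eq (0≤* (0≤1/ i) (0≤1/ (suc i))))
      where
      v w : ℚ
      v = + 1 / suc i
      w = + 1 / suc (suc i)
      eq : v * w ≡ v - w
      eq = begin-equality
        v * w
          ≡⟨ solve 3 (λ v w k → v :* w := v :* ((con 1ℚ :+ k) :* w) :- w :* (k :* v)) refl v w (ι (suc i)) ⟩
        v * (ι (suc (suc i)) * w) - w * (ι (suc i) * v)
          ≡⟨ cong₂ (λ p q → v * p - w * q) (ι*1/ (suc i)) (ι*1/ i) ⟩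
        v * 1ℚ - w * 1ℚ
          ≡⟨ cong₂ _-_ (*-identityʳ v) (*-identityʳ w) ⟩
        v - w ∎

    a : ℕ → ℚ
    a = lnTerm n

    0≤a : ∀ i → 0ℚ ≤ a i
    0≤a i = 0≤* (0≤y^ (suc i)) (0≤1/ i)

    a-step : ∀ i → a (suc i) ≤ y * a i
    a-step i = begin
      y ^ suc (suc i) * (+ 1 / suc (suc i))   ≤⟨ *-monoˡ (0≤y^ (suc (suc i))) (1/-decreasing i) ⟩
      y ^ suc (suc i) * (+ 1 / suc i)         ≡⟨ *-assoc y (y ^ suc i) (+ 1 / suc i) ⟩
      y * a i                                 ∎

    ratio : ∀ i → 0 ℕ.≤ i → a i ≤ K * (a i - a (suc i))
    ratio i _ = begin
      a i                     ≡⟨ sym (*-identityʳ (a i)) ⟩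
      a i * 1ℚ                ≡⟨ cong (a i *_) (sym (ι*1/ n)) ⟩
      a i * (K * u)           ≡⟨ solve 3 (λ a k u → a :* (k :* u) := k :* (a :- (con 1ℚ :- u) :* a)) refl (a i) K u ⟩
      K * (a i - y * a i)     ≤⟨ *-monoˡ (0≤ι (suc n)) (+-monoʳ-≤ (a i) (neg-antimono-≤ (a-step i))) ⟩
      K * (a i - a (suc i))   ∎

    ln-cauchy : IsCauchy (∑ a)
    ln-cauchy = Ratio.∑-cauchy a 0≤a K (0<ι n) 0 ratio

-- ln 0 is a junk value.
ln : ℕ → ℝ
ln zero    = fromℚ 0ℚ
ln (suc n) = mkℝ (∑ (lnTerm n)) (Ln.ln-cauchy n)

infixr 8 _^ᵣ_

_^ᵣ_ : ℕ → ℝ → ℝ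
zero      ^ᵣ x = fromℚ 0ℚ
m@(suc _) ^ᵣ x = exp (x *ᵣ ln m)

data ℕ∞ : Set where
  fin : ℕ → ℕ∞
  ∞   : ℕ∞

infix 4 _≤∞_ _=O_

_≤∞_ : ℕ∞ → ℝ → Set
fin n ≤∞ x = fromℕ n ≤ᵣ x
∞     ≤∞ x = ⊥

-- No absolute values are needed: f is nonnegative, and this is only used for
-- functions g that are positive for r ≥ 1.
_=O_ : (ℕ → ℕ∞) → (ℕ → ℝ) → Set
f =O g = ∃[ C ] ∃[ N ] ∀ r → N ℕ.≤ r → f r ≤∞ C *ᵣ g r

module Polynomial {c ℓ} (R : CommutativeRing c ℓ) where

  private module R = CommutativeRing R
  open R using (Carrier; _≈_; 0#; 1#)

  -- a₀ ∷ a₁ ∷ … ∷ [] stands for a₀ + a₁ t + …; trailing zeros are allowed,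
  -- which is why equality is _≈ₚ_.
  Poly : Set c
  Poly = List Carrier

  coeff : Poly → ℕ → Carrier
  coeff []      _       = 0#
  coeff (a ∷ f) zero    = a
  coeff (a ∷ f) (suc n) = coeff f n

  infix  4 _≈ₚ_
  infixl 6 _+ₚ_
  infixl 7 _*ₚ_
  infixr 8 _^ₚ_

  _≈ₚ_ : Poly → Poly → Set ℓ
  f ≈ₚ g = ∀ n → coeff f n ≈ coeff g n

  _+ₚ_ : Poly → Poly → Poly
  []      +ₚ g       = g
  (a ∷ f) +ₚ []      = a ∷ f
  (a ∷ f) +ₚ (b ∷ g) = a R.+ b ∷ f +ₚ g

  _*ₚ_ : Poly → Poly → Poly
  []      *ₚ g = []
  (a ∷ f) *ₚ g = map (a R.*_) g +ₚ (0# ∷ f *ₚ g)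

  _^ₚ_ : Poly → ℕ → Poly
  f ^ₚ zero  = 1# ∷ []
  f ^ₚ suc k = f *ₚ f ^ₚ k

  sumₚ : List Poly → Poly
  sumₚ = foldr _+ₚ_ []

  eval : Poly → Carrier → Carrier
  eval []      x = 0#
  eval (a ∷ f) x = a R.+ x R.* eval f x

module _ {c ℓ₁ ℓ₂} (F : HeytingField c ℓ₁ ℓ₂) where

  private module F = HeytingField F
  open F using (Carrier; _≈_; 0#; 1#)

  fieldRing : CommutativeRing c ℓ₁
  fieldRing = HeytingCommutativeRing.commutativeRing F.heytingCommutativeRing

  open Polynomial fieldRing

  AlgebraicallyClosed : Set (c ⊔ ℓ₁)
  AlgebraicallyClosed =
    ∀ (f : Poly) → (∃[ n ] ¬ (coeff f (suc n) ≈ 0#)) → ∃[ x ] eval f x ≈ 0#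

  -- p generates the kernel of the ring homomorphism ℤ → F.
  HasCharacteristic : ℕ → Set ℓ₁
  HasCharacteristic p = ∀ n → (n ·1 ≈ 0#) ⇔ p ∣ n
    where
    _·1 : ℕ → Carrier
    n ·1 = RawMonoid._×_ (CommutativeRing.+-rawMonoid fieldRing) n 1#

  IsSumOfPowers : ℕ → ℕ → Poly → Set (c ⊔ ℓ₁)
  IsSumOfPowers k s f = ∃[ gs ] length gs ℕ.≤ s × sumₚ (map (_^ₚ k) gs) ≈ₚ f

  Suffices : ℕ → ℕ → Set (c ⊔ ℓ₁)
  Suffices k s = ∀ f → IsSumOfPowers k s f

  IsWaringNumber : ℕ → ℕ∞ → Set (c ⊔ ℓ₁)
  IsWaringNumber k (fin s) = Suffices k s × (∀ s′ → Suffices k s′ → s ℕ.≤ s′)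
  IsWaringNumber k ∞       = ∀ s → ¬ Suffices k s

private
  least : ∀ {a} → ExcludedMiddle a → (P : ℕ → Set a) → ∀ n → P n →
          ∃[ m ] P m × (∀ j → P j → m ℕ.≤ j)
  least em P = <-rec _ step
    where
    step : ∀ n → (∀ {m} → m ℕ.< n → P m → ∃[ l ] P l × (∀ j → P j → l ℕ.≤ j)) →
           P n → ∃[ m ] P m × (∀ j → P j → m ℕ.≤ j)
    step n rec Pn with em {∃[ j ] j ℕ.< n × P j}
    ... | yes (j , j<n , Pj) = rec j<n Pj
    ... | no none = n , Pn , λ j Pj → ℕ.≮⇒≥ λ j<n → none (j , j<n , Pj)

module _ {c ℓ₁ ℓ₂} (em : ExcludedMiddle (c ⊔ ℓ₁)) (F : HeytingField c ℓ₁ ℓ₂) where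

  -- The minimum exists only classically: Suffices is not a decidable
  -- predicate.
  waringNumber : ∀ k → ∃[ n ] IsWaringNumber F k n
  waringNumber k with em {∃[ s ] Suffices F k s}
  ... | yes (s , ok) = let m , min = least em (Suffices F k) s ok in fin m , min
  ... | no none      = ∞ , λ s ok → none (s , ok)

  v : ℕ → ℕ∞
  v k = proj₁ (waringNumber k)

{-# OPTIONS --safe #-}
module Submission where

-- Let k = p^r - 1, D = r (p - 1), and let n ≡ 1 modulo r.  Modulo k, p^n ≡ p, so
-- K = (p - 1) ∑_{j<r} p^(nj) is a multiple of k, and a K-th power is a k-th power.
-- For b in F with b^(p^n) = b,
--   (1 + b y)^K = ∏_{j<r} (1 + b y^(p^(nj)))^(p-1)
-- is a polynomial of degree D in b whose linear coefficient is - S(y), where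
-- S(y) = ∑_{j<r} y^(p^(nj)).  Interpolating at D + 1 such b writes S(y) as a linear
-- combination of D + 1 k-th powers, and scalars are k-th powers.  S telescopes:
-- B(y) = S(y) - S(y^(p^n)) = y - y^(p^(nr)), and y is a linear combination of B(y) and
-- B(β y) for suitable β.  Hence v(p, k) ≤ 4 (D + 1), which is linear in r.
--
-- The nodes b are conjugates ζ^(p^i) of one ζ with ζ^(p^n) = ζ ≠ ζ^p.  Taking
-- n = (D + 1)! + 1 makes n ≡ 1 modulo every d ≤ D + 1, so no such d is a period of
-- the conjugates.

-- Why K replaces k: with n = 1 the exponent K is k itself, but the nodes must then satisfy b^p = b,
-- and these are only p elements, fewer than D + 1 once r > 1. Passing to p^n enlarges the supply of
-- nodes, leaves the degree in b at D, and the congruence keeps every K-th power a k-th power. The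
-- polynomials that are raised to the power k acquire enormous degrees, which the definition of v
-- permits.
--
-- The nodes do not come from counting the roots of X^(p^n) - X, which would require separability
-- and splitting. A nonzero x with x + x^p + ... + x^(p^(n-1)) = 0 and a solution of ζ^p = ζ + x
-- yield a single ζ, and its conjugates are numerous enough.
--
-- Identities between polynomials are verified on values: nodes exist in any number, so F is
-- infinite and values determine coefficients.
--
-- The bound linear in r is stronger than the claim. For the comparison it is enough that the
-- rational approximations of both stated exponents are eventually at least 2.

open import Defs
open import Algebra.Apartness.Bundles using (HeytingField)
open import Algebra.Bundles using (CommutativeRing)
import Algebra.Properties.CommutativeSemiring.Binomial as Binomial
import Algebra.Properties.Semiring.Mult as Mult
open import Axiom.ExcludedMiddle using (ExcludedMiddle)
open import Data.Fin.Base using (Fin; toℕ; inject₁)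
  renaming (zero to fzero; suc to fsuc; fromℕ to fmax)
open import Data.Fin.Properties
  using (suc-injective; toℕ-injective; toℕ-fromℕ; toℕ-inject₁; toℕ<n)
import Data.Integer.Base as ℤ
import Data.Integer.Properties as ℤ
open import Data.List.Base using ([]; _∷_; length; map; tabulate; _++_)
open import Data.List.Properties using (length-tabulate; length-++; length-map; map-++)
open import Data.Nat.Base as ℕ using (ℕ; zero; suc; z≤n; s≤s; _!)
open import Data.Nat.Combinatorics using (_C_; nCn≡1; nCk≡n!/k![n-k]!; k![n∸k]!∣n!)
open import Data.Nat.Divisibility
  using (_∣_; divides; ∣-refl; ∣-trans; ∣⇒≤; ∣1⇒≡1; m∣m*n; m≤n⇒m!∣n!)
open import Data.Nat.DivMod using (m/n*n≡m)
open import Data.Nat.Primality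
  using (Prime; euclidsLemma; prime⇒nonTrivial; prime⇒nonZero; ¬prime[1])
import Data.Nat.Properties as ℕ
import Data.Nat.Solver as ℕ
open import Data.Product.Base using (Σ; ∃-syntax; _×_; _,_; proj₁; proj₂)
open import Data.Rational.Base as ℚ using (ℚ; 0ℚ; 1ℚ; _/_; toℚᵘ; nonNegative)
import Data.Rational.Properties as ℚ
import Data.Rational.Solver as ℚ
import Data.Rational.Unnormalised.Base as ℚᵘ
import Data.Rational.Unnormalised.Properties as ℚᵘ
open import Data.Sum.Base using (inj₁; inj₂)
open import Data.Vec.Functional using (Vector)
open import Function.Base using (_∘_)
open import Function.Bundles using (module Equivalence)
open import Level using (_⊔_)
open import Relation.Binary.Definitions using (tri<; tri≈; tri>)
open import Relation.Binary.PropositionalEquality as ≡ using (_≡_)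
open import Relation.Nullary using (¬_; yes; no; contradiction)
open import Relation.Nullary.Decidable using (from-yes)

open import Algebra.Definitions.RawSemiring ℚ.+-*-rawSemiring using () renaming (_^_ to _^ℚ_)

-- Polynomials and interpolation

module PolynomialProperties {c ℓ} (R : CommutativeRing c ℓ) where

  open CommutativeRing R hiding (zero)
  open Polynomial R
  open import Algebra.Properties.CommutativeSemiring.Exp commutativeSemiring
  open import Algebra.Properties.Semiring.Sum semiring
  open import Algebra.Properties.Ring ring using (-‿distribˡ-*)
  open import Algebra.Properties.Group +-group using (x∙y⁻¹≈ε⇒x≈y) renaming (//-rightDividesʳ to x+y-y)
  open import Algebra.Solver.Ring.NaturalCoefficients.Default commutativeSemiring
    using (solve; _:=_; _:+_; _:*_)
  open import Relation.Binary.Reasoning.Setoid setoid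

  HasRoots : Set (c ⊔ ℓ)
  HasRoots = ∀ f → (∃[ n ] ¬ coeff f (suc n) ≈ 0#) → ∃[ x ] eval f x ≈ 0#

  HasInverses : Set (c ⊔ ℓ)
  HasInverses = ∀ x → ¬ x ≈ 0# → ∃[ y ] y * x ≈ 1#

  coeff-+ : ∀ f g n → coeff (f +ₚ g) n ≈ coeff f n + coeff g n
  coeff-+ []      g       n       = sym (+-identityˡ _)
  coeff-+ (a ∷ f) []      n       = sym (+-identityʳ _)
  coeff-+ (a ∷ f) (b ∷ g) zero    = refl
  coeff-+ (a ∷ f) (b ∷ g) (suc n) = coeff-+ f g n

  coeff-scale : ∀ a f n → coeff (map (a *_) f) n ≈ a * coeff f n
  coeff-scale a []      n       = sym (zeroʳ a)
  coeff-scale a (b ∷ f) zero    = refl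
  coeff-scale a (b ∷ f) (suc n) = coeff-scale a f n

  length-+ : ∀ f g {n} → length f ℕ.≤ n → length g ℕ.≤ n → length (f +ₚ g) ℕ.≤ n
  length-+ []      g       _         lg       = lg
  length-+ (a ∷ f) []      lf        _        = lf
  length-+ (a ∷ f) (b ∷ g) (s≤s lf) (s≤s lg) = s≤s (length-+ f g lf lg)

  eval-+ : ∀ f g x → eval (f +ₚ g) x ≈ eval f x + eval g x
  eval-+ []      g       x = sym (+-identityˡ _)
  eval-+ (a ∷ f) []      x = sym (+-identityʳ _)
  eval-+ (a ∷ f) (b ∷ g) x = begin
    a + b + x * eval (f +ₚ g) x             ≈⟨ +-congˡ (*-congˡ (eval-+ f g x)) ⟩
    a + b + x * (eval f x + eval g x)       ≈⟨ solve 5 (λ a b x f g →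
        a :+ b :+ x :* (f :+ g) := (a :+ x :* f) :+ (b :+ x :* g)) refl a b x (eval f x) (eval g x) ⟩
    (a + x * eval f x) + (b + x * eval g x) ∎

  eval-scale : ∀ a f x → eval (map (a *_) f) x ≈ a * eval f x
  eval-scale a []      x = sym (zeroʳ a)
  eval-scale a (b ∷ f) x = begin
    a * b + x * eval (map (a *_) f) x ≈⟨ +-congˡ (*-congˡ (eval-scale a f x)) ⟩
    a * b + x * (a * eval f x)        ≈⟨ solve 4 (λ a b x f →
        a :* b :+ x :* (a :* f) := a :* (b :+ x :* f)) refl a b x (eval f x) ⟩
    a * (b + x * eval f x)            ∎

  eval-* : ∀ f g x → eval (f *ₚ g) x ≈ eval f x * eval g x
  eval-* []      g x = sym (zeroˡ _)
  eval-* (a ∷ f) g x = begin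
    eval (map (a *_) g +ₚ (0# ∷ f *ₚ g)) x          ≈⟨ eval-+ (map (a *_) g) (0# ∷ f *ₚ g) x ⟩
    eval (map (a *_) g) x + (0# + x * eval (f *ₚ g) x)
      ≈⟨ +-cong (eval-scale a g x) (trans (+-identityˡ _) (*-congˡ (eval-* f g x))) ⟩
    a * eval g x + x * (eval f x * eval g x)        ≈⟨ solve 4 (λ a x f g →
        a :* g :+ x :* (f :* g) := (a :+ x :* f) :* g) refl a x (eval f x) (eval g x) ⟩
    (a + x * eval f x) * eval g x                   ∎

  eval-const : ∀ a x → eval (a ∷ []) x ≈ a
  eval-const a x = trans (+-congˡ (zeroʳ x)) (+-identityʳ a)

  eval-^ : ∀ f n x → eval (f ^ₚ n) x ≈ eval f x ^ n
  eval-^ f zero    x = eval-const 1# x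
  eval-^ f (suc n) x = trans (eval-* f (f ^ₚ n) x) (*-congˡ (eval-^ f n x))

  eval-sum-++ : ∀ fs gs x → eval (sumₚ (fs ++ gs)) x ≈ eval (sumₚ fs) x + eval (sumₚ gs) x
  eval-sum-++ []       gs x = sym (+-identityˡ _)
  eval-sum-++ (f ∷ fs) gs x = begin
    eval (f +ₚ sumₚ (fs ++ gs)) x                      ≈⟨ eval-+ f (sumₚ (fs ++ gs)) x ⟩
    eval f x + eval (sumₚ (fs ++ gs)) x                ≈⟨ +-congˡ (eval-sum-++ fs gs x) ⟩
    eval f x + (eval (sumₚ fs) x + eval (sumₚ gs) x)   ≈⟨ +-assoc _ _ _ ⟨
    eval f x + eval (sumₚ fs) x + eval (sumₚ gs) x     ≈⟨ +-congʳ (eval-+ f (sumₚ fs) x) ⟨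
    eval (f +ₚ sumₚ fs) x + eval (sumₚ gs) x           ∎

  eval-zero : ∀ f {x} → x ≈ 0# → eval f x ≈ coeff f 0
  eval-zero []      x≈0 = refl
  eval-zero (a ∷ f) x≈0 = trans (+-congˡ (trans (*-congʳ x≈0) (zeroˡ _))) (+-identityʳ a)

  monomial : ℕ → Poly
  monomial zero    = 1# ∷ []
  monomial (suc n) = 0# ∷ monomial n

  coeff-monomial : ∀ n → coeff (monomial n) n ≈ 1#
  coeff-monomial zero    = refl
  coeff-monomial (suc n) = coeff-monomial n

  coeff-monomial-≢ : ∀ m n → ¬ m ≡ n → coeff (monomial m) n ≈ 0#
  coeff-monomial-≢ zero    zero    m≢n = contradiction ≡.refl m≢n
  coeff-monomial-≢ zero    (suc n) m≢n = refl
  coeff-monomial-≢ (suc m) zero    m≢n = refl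
  coeff-monomial-≢ (suc m) (suc n) m≢n = coeff-monomial-≢ m n (m≢n ∘ ≡.cong suc)

  eval-monomial : ∀ n x → eval (monomial n) x ≈ x ^ n
  eval-monomial zero    x = eval-const 1# x
  eval-monomial (suc n) x = trans (+-identityˡ _) (*-congˡ (eval-monomial n x))

  -- Horner's intermediate values at b. By `ruffini` they are the coefficients of the quotient of X
  -- f by X - b.
  tails : Carrier → Poly → Poly
  tails b []      = []
  tails b (a ∷ f) = eval (a ∷ f) b ∷ tails b f

  length-tails : ∀ b f → length (tails b f) ≡ length f
  length-tails b []      = ≡.refl
  length-tails b (a ∷ f) = ≡.cong suc (length-tails b f)

  coeff-tails-0 : ∀ b f → coeff (tails b f) 0 ≈ eval f b
  coeff-tails-0 b []      = refl
  coeff-tails-0 b (a ∷ f) = refl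

  coeff-tails : ∀ b f n → coeff (tails b f) n ≈ coeff f n + b * coeff (tails b f) (suc n)
  coeff-tails b []      n       = sym (trans (+-identityˡ _) (zeroʳ b))
  coeff-tails b (a ∷ f) zero    = +-congˡ (*-congˡ (sym (coeff-tails-0 b f)))
  coeff-tails b (a ∷ f) (suc n) = coeff-tails b f n

  -- The division identity at the point d + b. Taking the difference d as a variable keeps it free
  -- of subtraction, so that the semiring solver applies.
  ruffini : ∀ b d f → (d + b) * eval f (d + b) ≈ b * eval f b + d * eval (tails b f) (d + b)
  ruffini b d []      = trans (zeroʳ _) (sym (trans (+-cong (zeroʳ b) (zeroʳ d)) (+-identityˡ 0#)))
  ruffini b d (a ∷ f) = begin
    (d + b) * (a + (d + b) * eval f (d + b))
      ≈⟨ *-congˡ (+-congˡ (ruffini b d f)) ⟩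
    (d + b) * (a + (b * y + d * z))
      ≈⟨ solve 5 (λ a b d y z → (d :+ b) :* (a :+ (b :* y :+ d :* z)) :=
           b :* (a :+ b :* y) :+ d :* ((a :+ b :* y) :+ (d :+ b) :* z)) refl a b d y z ⟩
    b * (a + b * y) + d * ((a + b * y) + (d + b) * z) ∎
    where
    y = eval f b
    z = eval (tails b f) (d + b)

  eval-cong : ∀ f {x y} → x ≈ y → eval f x ≈ eval f y
  eval-cong []      x≈y = refl
  eval-cong (a ∷ f) x≈y = +-congˡ (*-cong x≈y (eval-cong f x≈y))

  ruffini-∷ : ∀ b x a f → eval (a ∷ f) x ≈ eval (a ∷ f) b + (x - b) * eval (tails b f) x
  ruffini-∷ b x a f = begin
    a + x * eval f x
      ≈⟨ +-congˡ (*-cong (sym x-b+b) (eval-cong f (sym x-b+b))) ⟩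
    a + (x - b + b) * eval f (x - b + b)
      ≈⟨ +-congˡ (ruffini b (x - b) f) ⟩
    a + (b * eval f b + (x - b) * eval (tails b f) (x - b + b))
      ≈⟨ +-congˡ (+-congˡ (*-congˡ (eval-cong (tails b f) x-b+b))) ⟩
    a + (b * eval f b + (x - b) * eval (tails b f) x)
      ≈⟨ +-assoc _ _ _ ⟨
    a + b * eval f b + (x - b) * eval (tails b f) x ∎
    where
    x-b+b : x - b + b ≈ x
    x-b+b = trans (+-assoc _ _ _) (trans (+-congˡ (-‿inverseˡ b)) (+-identityʳ x))

  -- Dividing a + X f by X - b gives the same quotient as dividing X f, hence `tails b f`, one entry
  -- shorter.
  quotient : Carrier → Poly → Poly
  quotient b []      = []
  quotient b (a ∷ f) = tails b f

  length-quotient : ∀ b f {n} → length f ℕ.≤ suc n → length (quotient b f) ℕ.≤ n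
  length-quotient b []      _         = z≤n
  length-quotient b (a ∷ f) (s≤s l≤n) = ℕ.≤-trans (ℕ.≤-reflexive (length-tails b f)) l≤n

  eval-quotient : ∀ b f x → eval f x ≈ eval f b + (x - b) * eval (quotient b f) x
  eval-quotient b []      x = sym (trans (+-identityˡ _) (zeroʳ _))
  eval-quotient b (a ∷ f) x = ruffini-∷ b x a f

  coeff-quotient-0 : ∀ b f → coeff f 0 ≈ eval f b + - b * coeff (quotient b f) 0
  coeff-quotient-0 b []      = sym (trans (+-identityˡ _) (zeroʳ _))
  coeff-quotient-0 b (a ∷ f) = begin
    a                                              ≈⟨ x+y-y (b * eval f b) a ⟨
    a + b * eval f b + - (b * eval f b)            ≈⟨ +-congˡ (-‿cong (*-congˡ (coeff-tails-0 b f))) ⟨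
    a + b * eval f b + - (b * coeff (tails b f) 0) ≈⟨ +-congˡ (-‿distribˡ-* _ _) ⟩
    a + b * eval f b + - b * coeff (tails b f) 0   ∎

  coeff-quotient-suc : ∀ b f n →
    coeff f (suc n) ≈ coeff (quotient b f) n + - b * coeff (quotient b f) (suc n)
  coeff-quotient-suc b []      n = sym (trans (+-identityˡ _) (zeroʳ _))
  coeff-quotient-suc b (a ∷ f) n = begin
    coeff f n                          ≈⟨ x+y-y (b * q) (coeff f n) ⟨
    coeff f n + b * q + - (b * q)      ≈⟨ +-cong (sym (coeff-tails b f n)) (-‿distribˡ-* b q) ⟩
    coeff (tails b f) n + - b * q      ∎
    where q = coeff (tails b f) (suc n)

  module _ (inverse : HasInverses) where

    module Nodes {N} (b : Vector Carrier N) where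

      -- The weights are chosen before P. In the application P varies with the point x of
      -- evaluation, and only weights independent of x can become scalar factors of polynomials.
      Interpolable : (Poly → Carrier) → Set (c ⊔ ℓ)
      Interpolable φ = Σ (Vector Carrier N) λ w → ∀ P → length P ℕ.≤ N → φ P ≈ ∑[ i < N ] (w i * eval P (b i))

      interpolable-+ : ∀ {φ ψ} → Interpolable φ → Interpolable ψ → Interpolable (λ P → φ P + ψ P)
      interpolable-+ {φ} {ψ} (w , φ≈) (w′ , ψ≈) = (λ i → w i + w′ i) , λ P l → begin
        φ P + ψ P
          ≈⟨ +-cong (φ≈ P l) (ψ≈ P l) ⟩
        ∑[ i < N ] (w i * eval P (b i)) + ∑[ i < N ] (w′ i * eval P (b i))
          ≈⟨ ∑-distrib-+ (λ i → w i * eval P (b i)) (λ i → w′ i * eval P (b i)) ⟨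
        ∑[ i < N ] (w i * eval P (b i) + w′ i * eval P (b i))
          ≈⟨ sum-cong-≋ (λ i → sym (distribʳ (eval P (b i)) (w i) (w′ i))) ⟩
        ∑[ i < N ] ((w i + w′ i) * eval P (b i)) ∎

      interpolable-* : ∀ {φ} a → Interpolable φ → Interpolable (λ P → a * φ P)
      interpolable-* {φ} a (w , φ≈) = (λ i → a * w i) , λ P l → begin
        a * φ P                                      ≈⟨ *-congˡ (φ≈ P l) ⟩
        a * ∑[ i < N ] (w i * eval P (b i))          ≈⟨ *-distribˡ-sum a (λ i → w i * eval P (b i)) ⟩
        ∑[ i < N ] (a * (w i * eval P (b i)))        ≈⟨ sum-cong-≋ (λ i → sym (*-assoc a (w i) (eval P (b i)))) ⟩
        ∑[ i < N ] (a * w i * eval P (b i))          ∎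

      interpolable-≈ : ∀ {φ ψ} → (∀ P → ψ P ≈ φ P) → Interpolable φ → Interpolable ψ
      interpolable-≈ ψ≈φ (w , φ≈) = w , λ P l → trans (ψ≈φ P) (φ≈ P l)

    open Nodes using (Interpolable)

    interpolable-node₀ : ∀ {N} (b : Vector Carrier (suc N)) → Interpolable b (λ P → eval P (b fzero))
    interpolable-node₀ {N} b = w , λ P _ → begin
      eval P (b fzero)             ≈⟨ +-identityʳ _ ⟨
      eval P (b fzero) + 0#        ≈⟨ +-cong (sym (*-identityˡ _)) (sym (zeros P)) ⟩
      1# * eval P (b fzero) + ∑[ i < N ] (0# * eval P (b (fsuc i))) ∎
      where
      w : Vector Carrier (suc N)
      w fzero    = 1#
      w (fsuc _) = 0#
      zeros : ∀ P → ∑[ i < N ] (0# * eval P (b (fsuc i))) ≈ 0#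
      zeros P = trans (sum-cong-≋ {N} (λ i → zeroˡ (eval P (b (fsuc i))))) (sum-replicate-zero N)

    -- The quotient of P by X - b₀ takes the value (P(bᵢ) - P(b₀)) / (bᵢ - b₀) at bᵢ.
    interpolable-quotient : ∀ {N} (b : Vector Carrier (suc N)) →
      (∀ {i j} → b i ≈ b j → i ≡ j) → ∀ {φ} → Interpolable (b ∘ fsuc) φ →
      Interpolable b (λ P → φ (quotient (b fzero) P))
    interpolable-quotient {N} b b-inj {φ} (w , φ≈) = w′ , λ P l → begin
      φ (quotient b₀ P)
        ≈⟨ φ≈ (quotient b₀ P) (length-quotient b₀ P l) ⟩
      ∑[ i < N ] (w i * eval (quotient b₀ P) (b (fsuc i)))
        ≈⟨ sum-cong-≋ (step P) ⟩
      ∑[ i < N ] (u i * eval P b₀ + w′ (fsuc i) * eval P (b (fsuc i)))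
        ≈⟨ ∑-distrib-+ (λ i → u i * eval P b₀) (λ i → w′ (fsuc i) * eval P (b (fsuc i))) ⟩
      ∑[ i < N ] (u i * eval P b₀) + ∑[ i < N ] (w′ (fsuc i) * eval P (b (fsuc i)))
        ≈⟨ +-congʳ (*-distribʳ-sum (eval P b₀) u) ⟨
      sum u * eval P b₀ + ∑[ i < N ] (w′ (fsuc i) * eval P (b (fsuc i))) ∎
      where
      b₀ : Carrier
      b₀ = b fzero

      gap : ∀ i → ∃[ y ] y * (b (fsuc i) - b₀) ≈ 1#
      gap i = inverse (b (fsuc i) - b₀) λ eq → contradiction (b-inj (x∙y⁻¹≈ε⇒x≈y _ _ eq)) λ ()

      y u : Vector Carrier N
      y i = proj₁ (gap i)
      u i = - (w i * y i)

      w′ : Vector Carrier (suc N)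
      w′ fzero    = sum u
      w′ (fsuc i) = w i * y i

      step : ∀ P i → w i * eval (quotient b₀ P) (b (fsuc i)) ≈
                     u i * eval P b₀ + w′ (fsuc i) * eval P (b (fsuc i))
      step P i = sym (begin
        u i * p + w i * y i * eval P x
          ≈⟨ +-congˡ (*-congˡ (eval-quotient b₀ P x)) ⟩
        u i * p + w i * y i * (p + (x - b₀) * q)
          ≈⟨ solve 6 (λ u w y p g q → u :* p :+ w :* y :* (p :+ g :* q) :=
               (w :* y :+ u) :* p :+ w :* (y :* g) :* q) refl (u i) (w i) (y i) p (x - b₀) q ⟩
        (w i * y i + u i) * p + w i * (y i * (x - b₀)) * q
          ≈⟨ +-cong (*-congʳ (-‿inverseʳ (w i * y i))) (*-congʳ (*-congˡ (proj₂ (gap i)))) ⟩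
        0# * p + w i * 1# * q
          ≈⟨ +-cong (zeroˡ p) (*-congʳ (*-identityʳ (w i))) ⟩
        0# + w i * q
          ≈⟨ +-identityˡ _ ⟩
        w i * q ∎)
        where
        x = b (fsuc i)
        p = eval P b₀
        q = eval (quotient b₀ P) x

    -- Newton's scheme instead of a Vandermonde inverse: P = P(b₀) + (X - b₀) q expresses every
    -- coefficient of P by P(b₀) and coefficients of q, and q, one entry shorter, is interpolated at
    -- the remaining nodes.
    interpolable-coeff : ∀ {N} (b : Vector Carrier N) → (∀ {i j} → b i ≈ b j → i ≡ j) →
      ∀ n → Interpolable b (λ P → coeff P n)
    interpolable-coeff {zero}  b b-inj n = (λ ()) , λ { [] _ → refl }
    interpolable-coeff {suc N} b b-inj = go
      where
      open Nodes b using (interpolable-+; interpolable-*; interpolable-≈)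
      b₀ : Carrier
      b₀ = b fzero
      quot : ∀ n → Interpolable b (λ P → coeff (quotient b₀ P) n)
      quot n = interpolable-quotient b b-inj
        (interpolable-coeff (b ∘ fsuc) (λ eq → suc-injective (b-inj eq)) n)
      go : ∀ n → Interpolable b (λ P → coeff P n)
      go zero    = interpolable-≈ (coeff-quotient-0 b₀)
        (interpolable-+ (interpolable-node₀ b) (interpolable-* (- b₀) (quot 0)))
      go (suc n) = interpolable-≈ (λ P → coeff-quotient-suc b₀ P n)
        (interpolable-+ (quot n) (interpolable-* (- b₀) (quot (suc n))))

    -- A coefficient is a fixed combination of the values at sufficiently many distinct nodes. This
    -- is what allows representations by powers to be checked on values.
    evals-≈⇒≈ₚ : (∀ N → Σ (Vector Carrier N) λ b → ∀ {i j} → b i ≈ b j → i ≡ j) →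
      ∀ f g → (∀ x → eval f x ≈ eval g x) → f ≈ₚ g
    evals-≈⇒≈ₚ nodes f g f≈g n = begin
      coeff f n                       ≈⟨ coeff≈ f (ℕ.m≤m+n _ _) ⟩
      ∑[ i < N ] (w i * eval f (b i)) ≈⟨ sum-cong-≋ {N} (λ i → *-congˡ {w i} (f≈g (b i))) ⟩
      ∑[ i < N ] (w i * eval g (b i)) ≈⟨ coeff≈ g (ℕ.m≤n+m _ _) ⟨
      coeff g n                       ∎
      where
      N = length f ℕ.+ length g
      b = proj₁ (nodes N)
      w = proj₁ (interpolable-coeff b (proj₂ (nodes N)) n)
      coeff≈ = proj₂ (interpolable-coeff b (proj₂ (nodes N)) n)

-- The Frobenius endomorphism

prime∤! : ∀ {p} → Prime p → ∀ {n} → n ℕ.< p → ¬ p ∣ n !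
prime∤! pr {zero}  _   p∣1 with ≡.refl ← ∣1⇒≡1 p∣1 = ¬prime[1] pr
prime∤! pr {suc n} n<p p∣n! with euclidsLemma (suc n) (n !) pr p∣n!
... | inj₁ p∣1+n = ℕ.<⇒≱ n<p (∣⇒≤ p∣1+n)
... | inj₂ p∣n!  = prime∤! pr (ℕ.<-trans (ℕ.n<1+n n) n<p) p∣n!

-- p divides p! = C(p,k) k! (p-k)!, but neither factorial on the right, both being of numbers below
-- p.
prime∣C : ∀ {p} → Prime p → ∀ {k} → 0 ℕ.< k → k ℕ.< p → p ∣ p C k
prime∣C {p@(suc p′)} pr {k} 0<k k<p with euclidsLemma (p C k) (k ! ℕ.* (p ℕ.∸ k) !) pr p∣
  where
  instance _ = k ℕ.!* (p ℕ.∸ k) !≢0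
  eq : (p C k) ℕ.* (k ! ℕ.* (p ℕ.∸ k) !) ≡ p !
  eq = ≡.trans (≡.cong (ℕ._* (k ! ℕ.* (p ℕ.∸ k) !)) (nCk≡n!/k![n-k]! (ℕ.<⇒≤ k<p)))
               (m/n*n≡m (k![n∸k]!∣n! (ℕ.<⇒≤ k<p)))
  p∣ : p ∣ (p C k) ℕ.* (k ! ℕ.* (p ℕ.∸ k) !)
  p∣ = ≡.subst (p ∣_) (≡.sym eq) (m∣m*n (p′ !))
... | inj₁ p∣C = p∣C
... | inj₂ p∣! with euclidsLemma (k !) ((p ℕ.∸ k) !) pr p∣!
...   | inj₁ p∣k! = contradiction p∣k! (prime∤! pr k<p)
...   | inj₂ p∣[p∸k]! = contradiction p∣[p∸k]! (prime∤! pr (ℕ.m<n+o⇒m∸n<o p k (ℕ.m<n+m p 0<k)))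

module Frobenius {c ℓ} (R : CommutativeRing c ℓ) where

  open CommutativeRing R hiding (zero)
  open import Algebra.Properties.CommutativeSemiring.Exp commutativeSemiring
  open import Algebra.Properties.Semiring.Sum semiring
  open Mult semiring using (×-assocˡ; ×-assoc-*; ×-congʳ; ×-homo-1) renaming (_×_ to _·_)
  open import Relation.Binary.Reasoning.Setoid setoid

  module _ {p} (p·1≈0 : p · 1# ≈ 0#) where

    p·x≈0 : ∀ x → p · x ≈ 0#
    p·x≈0 x = begin
      p · x          ≈⟨ ×-congʳ p (*-identityˡ x) ⟨
      p · (1# * x)   ≈⟨ ×-assoc-* p 1# x ⟨
      p · 1# * x     ≈⟨ *-congʳ p·1≈0 ⟩
      0# * x         ≈⟨ zeroˡ x ⟩
      0#             ∎

    n·0≈0 : ∀ n → n · 0# ≈ 0#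
    n·0≈0 zero    = refl
    n·0≈0 (suc n) = trans (+-identityˡ _) (n·0≈0 n)

    p∣n⇒n·x≈0 : ∀ {n} → p ∣ n → ∀ x → n · x ≈ 0#
    p∣n⇒n·x≈0 (divides q ≡.refl) x = begin
      (q ℕ.* p) · x   ≈⟨ ×-assocˡ x q p ⟨
      q · (p · x)     ≈⟨ ×-congʳ q (p·x≈0 x) ⟩
      q · 0#          ≈⟨ n·0≈0 q ⟩
      0#              ∎

  frobenius-+ : ∀ {p} → Prime p → p · 1# ≈ 0# → ∀ x y → (x + y) ^ p ≈ x ^ p + y ^ p
  frobenius-+ {p@(suc p′)} pr p·1≈0 x y = begin
    (x + y) ^ p
      ≈⟨ Binomial.theorem commutativeSemiring p x y ⟩
    1 · (1# * y ^ p) + sum (t ∘ fsuc)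
      ≈⟨ +-cong (trans (×-homo-1 _) (*-identityˡ _)) (sum-init-last (t ∘ fsuc)) ⟩
    y ^ p + (∑[ i < p′ ] t (fsuc (inject₁ i)) + t (fsuc (fmax p′)))
      ≈⟨ +-congˡ (+-cong middle last) ⟩
    y ^ p + (0# + x ^ p)
      ≈⟨ trans (+-congˡ (+-identityˡ _)) (+-comm _ _) ⟩
    x ^ p + y ^ p ∎
    where
    t : Vector Carrier (suc p)
    t = Binomial.binomialTerm commutativeSemiring x y p

    middle : ∑[ i < p′ ] t (fsuc (inject₁ i)) ≈ 0#
    middle = trans (sum-cong-≋ {p′} (λ i → p∣n⇒n·x≈0 p·1≈0
      (prime∣C pr (s≤s z≤n) (s≤s (≡.subst (ℕ._< p′) (≡.sym (toℕ-inject₁ i)) (toℕ<n i)))) _))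
      (sum-replicate-zero p′)

    last : t (fsuc (fmax p′)) ≈ x ^ p
    last rewrite toℕ-fromℕ p′ | nCn≡1 p | ℕ.n∸n≡0 p′ = trans (×-homo-1 _) (*-identityʳ _)

  frobenius^-+ : ∀ {p} → Prime p → p · 1# ≈ 0# → ∀ n x y →
    (x + y) ^ (p ℕ.^ n) ≈ x ^ (p ℕ.^ n) + y ^ (p ℕ.^ n)
  frobenius^-+ pr p·1≈0 zero    x y = distribʳ 1# x y
  frobenius^-+ {p} pr p·1≈0 (suc n) x y = begin
    (x + y) ^ (p ℕ.* q)               ≈⟨ ^-assocʳ (x + y) p q ⟨
    ((x + y) ^ p) ^ q                 ≈⟨ ^-congˡ q (frobenius-+ pr p·1≈0 x y) ⟩
    (x ^ p + y ^ p) ^ q               ≈⟨ frobenius^-+ pr p·1≈0 n (x ^ p) (y ^ p) ⟩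
    (x ^ p) ^ q + (y ^ p) ^ q         ≈⟨ +-cong (^-assocʳ x p q) (^-assocʳ y p q) ⟩
    x ^ (p ℕ.* q) + y ^ (p ℕ.* q)     ∎
    where q = p ℕ.^ n

-- Artin-Schreier elements and their Frobenius orbits

module Roots {c ℓ} (R : CommutativeRing c ℓ)
  (closed : PolynomialProperties.HasRoots R)
  (1≉0 : ¬ CommutativeRing._≈_ R (CommutativeRing.1# R) (CommutativeRing.0# R))
  {p} (pr : Prime p)
  (p·1≈0 : CommutativeRing._≈_ R (Mult._×_ (CommutativeRing.semiring R) p (CommutativeRing.1# R))
                                 (CommutativeRing.0# R)) where

  open CommutativeRing R hiding (zero)
  open Polynomial R
  open PolynomialProperties R
  open Frobenius R
  open import Algebra.Properties.CommutativeSemiring.Exp commutativeSemiring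
  open import Algebra.Properties.Group +-group using (∙-cancelˡ)
  open import Algebra.Solver.Ring.NaturalCoefficients.Default commutativeSemiring
    using (solve; _:=_; _:+_)
  open import Relation.Binary.Reasoning.Setoid setoid

  1<p : 1 ℕ.< p
  1<p = ℕ.nonTrivial⇒n>1 p {{prime⇒nonTrivial pr}}

  0<p : 0 ℕ.< p
  0<p = ℕ.<-trans (s≤s z≤n) 1<p

  -a+x≈0⇒x≈a : ∀ {a x} → - a + x ≈ 0# → x ≈ a
  -a+x≈0⇒x≈a {a} eq = ∙-cancelˡ (- a) _ _ (trans eq (sym (-‿inverseˡ a)))

  power-root : ∀ {m} → 0 ℕ.< m → ∀ a → ∃[ x ] x ^ m ≈ a
  power-root {suc m} _ a with closed (- a ∷ monomial m)
    (m , λ eq → 1≉0 (trans (sym (coeff-monomial m)) eq))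
  ... | x , eq = x , -a+x≈0⇒x≈a (trans (+-congˡ (*-congˡ (sym (eval-monomial m x)))) eq)

  -- With 1 < m the term -X stays clear of the leading term. The case m = p is the Artin-Schreier
  -- equation behind ζ; the case m = `Q ^ r`, b = 1 gives the β that eliminates the top power.
  affine-root : ∀ {m} → 1 ℕ.< m → ∀ b → ∃[ x ] x ^ m ≈ x + b
  affine-root {suc (suc m)} (s≤s (s≤s _)) b with closed (- b ∷ - 1# ∷ monomial m)
    (suc m , λ eq → 1≉0 (trans (sym (coeff-monomial m)) eq))
  ... | x , eq = x , ∙-cancelˡ (- b + - x) _ _ (begin
    - b + - x + x * (x * x ^ m)           ≈⟨ +-assoc _ _ _ ⟩
    - b + (- x + x * (x * x ^ m))         ≈⟨ +-congˡ (+-congʳ (sym x*-1)) ⟩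
    - b + (x * - 1# + x * (x * x ^ m))    ≈⟨ +-congˡ (distribˡ x _ _) ⟨
    - b + x * (- 1# + x * x ^ m)          ≈⟨ +-congˡ (*-congˡ (+-congˡ (*-congˡ (eval-monomial m x)))) ⟨
    eval (- b ∷ - 1# ∷ monomial m) x      ≈⟨ eq ⟩
    0#                                    ≈⟨ +-identityˡ 0# ⟨
    0# + 0#                               ≈⟨ +-cong (-‿inverseˡ b) (-‿inverseˡ x) ⟨
    (- b + b) + (- x + x)                 ≈⟨ solve 4 (λ a b c d →
                                               (a :+ b) :+ (c :+ d) := (a :+ c) :+ (d :+ b)) refl (- b) b (- x) x ⟩
    - b + - x + (x + b)                   ∎)
    where
    open import Algebra.Properties.Ring ring using (-1*x≈-x)
    x*-1 : x * - 1# ≈ - x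
    x*-1 = trans (*-comm x (- 1#)) (-1*x≈-x x)

  -- x + x^q + ... + x^(q^(j-1)). For q = p it is the trace polynomial of the field with p^j
  -- elements over its prime field; for q = `Q` and j = r it is S.
  powerSum : ℕ → ℕ → Carrier → Carrier
  powerSum q zero    x = 0#
  powerSum q (suc j) x = x + powerSum q j (x ^ q)

  powerSum-cong : ∀ q j {x y} → x ≈ y → powerSum q j x ≈ powerSum q j y
  powerSum-cong q zero    x≈y = refl
  powerSum-cong q (suc j) x≈y = +-cong x≈y (powerSum-cong q j (^-congˡ q x≈y))

  -- The subtraction-free form of S(x) - S(x^q) = x - x^(q^j): both sides add up the same j + 1
  -- powers.
  powerSum-telescope : ∀ q j x → powerSum q j x + x ^ (q ℕ.^ j) ≈ x + powerSum q j (x ^ q)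
  powerSum-telescope q zero    x = trans (+-identityˡ _) (trans (*-identityʳ x) (sym (+-identityʳ x)))
  powerSum-telescope q (suc j) x = begin
    x + powerSum q j (x ^ q) + x ^ (q ℕ.* q ℕ.^ j)      ≈⟨ +-assoc _ _ _ ⟩
    x + (powerSum q j (x ^ q) + x ^ (q ℕ.* q ℕ.^ j))    ≈⟨ +-congˡ (+-congˡ (^-assocʳ x q (q ℕ.^ j))) ⟨
    x + (powerSum q j (x ^ q) + (x ^ q) ^ (q ℕ.^ j))    ≈⟨ +-congˡ (powerSum-telescope q j (x ^ q)) ⟩
    x + (x ^ q + powerSum q j ((x ^ q) ^ q))            ∎

  -- The sum of X^(q p^i - 1) over i < j. For q = 1 it is the trace polynomial divided by X, which
  -- removes the root 0; general q serves the recursion.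
  powerSumPoly : ℕ → ℕ → Poly
  powerSumPoly zero    q = []
  powerSumPoly (suc j) q = monomial (ℕ.pred q) +ₚ powerSumPoly j (q ℕ.* p)

  eval-powerSumPoly : ∀ j {q} → 0 ℕ.< q → ∀ x → x * eval (powerSumPoly j q) x ≈ powerSum p j (x ^ q)
  eval-powerSumPoly zero        _   x = zeroʳ x
  eval-powerSumPoly (suc j) {q} 0<q x = begin
    x * eval (monomial (ℕ.pred q) +ₚ g) x
      ≈⟨ *-congˡ (eval-+ (monomial (ℕ.pred q)) g x) ⟩
    x * (eval (monomial (ℕ.pred q)) x + eval g x)
      ≈⟨ distribˡ x _ _ ⟩
    x * eval (monomial (ℕ.pred q)) x + x * eval g x
      ≈⟨ +-cong (*-congˡ (eval-monomial (ℕ.pred q) x)) (eval-powerSumPoly j (ℕ.*-mono-< 0<q 0<p) x) ⟩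
    x ^ suc (ℕ.pred q) + powerSum p j (x ^ (q ℕ.* p))
      ≈⟨ +-cong (^-congʳ x (ℕ.suc-pred q {{ℕ.>-nonZero 0<q}})) (powerSum-cong p j (sym (^-assocʳ x q p))) ⟩
    x ^ q + powerSum p j ((x ^ q) ^ p) ∎
    where g = powerSumPoly j (q ℕ.* p)

  coeff-powerSumPoly-low : ∀ j {q e} → suc e ℕ.< q → coeff (powerSumPoly j q) e ≈ 0#
  coeff-powerSumPoly-low zero            _   = refl
  coeff-powerSumPoly-low (suc j) {q} {e} e<q = begin
    coeff (powerSumPoly (suc j) q) e
      ≈⟨ coeff-+ (monomial (ℕ.pred q)) (powerSumPoly j (q ℕ.* p)) e ⟩
    coeff (monomial (ℕ.pred q)) e + coeff (powerSumPoly j (q ℕ.* p)) e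
      ≈⟨ +-cong (coeff-monomial-≢ (ℕ.pred q) e (λ eq → ℕ.<⇒≢ (ℕ.<⇒≤pred e<q) (≡.sym eq)))
                (coeff-powerSumPoly-low j (ℕ.<-≤-trans e<q (ℕ.m≤m*n q p {{prime⇒nonZero pr}}))) ⟩
    0# + 0#
      ≈⟨ +-identityˡ 0# ⟩
    0# ∎

  coeff-powerSumPoly-pred : ∀ j {q} → 0 ℕ.< q → coeff (powerSumPoly (suc j) q) (ℕ.pred q) ≈ 1#
  coeff-powerSumPoly-pred j {q} 0<q = begin
    coeff (powerSumPoly (suc j) q) (ℕ.pred q)
      ≈⟨ coeff-+ (monomial (ℕ.pred q)) (powerSumPoly j (q ℕ.* p)) (ℕ.pred q) ⟩
    coeff (monomial (ℕ.pred q)) (ℕ.pred q) + coeff (powerSumPoly j (q ℕ.* p)) (ℕ.pred q)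
      ≈⟨ +-cong (coeff-monomial (ℕ.pred q)) (coeff-powerSumPoly-low j
           (≡.subst (ℕ._< q ℕ.* p) (≡.sym (ℕ.suc-pred q)) (ℕ.m<m*n q p 1<p))) ⟩
    1# + 0#
      ≈⟨ +-identityʳ 1# ⟩
    1# ∎
    where instance _ = ℕ.>-nonZero 0<q

  -- The divided trace polynomial has constant term 1, so its roots are nonzero. Its second summand
  -- X^(p-1), present because 1 < n, shows that its degree is positive; the index passed to `closed`
  -- is p - 2 because its successor is meant.
  powerSum-root : ∀ {n} → 1 ℕ.< n → ∃[ x ] ¬ x ≈ 0# × powerSum p n x ≈ 0#
  powerSum-root {suc (suc n)} (s≤s (s≤s _)) with closed f (ℕ.pred (ℕ.pred p) , λ eq → 1≉0 (trans (sym top) eq))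
    where
    f = powerSumPoly (suc (suc n)) 1
    0<1*p : 0 ℕ.< 1 ℕ.* p
    0<1*p = ≡.subst (0 ℕ.<_) (≡.sym (ℕ.*-identityˡ p)) 0<p
    index : suc (ℕ.pred (ℕ.pred p)) ≡ ℕ.pred (1 ℕ.* p)
    index = ≡.trans (ℕ.suc-pred (ℕ.pred p) {{ℕ.>-nonZero (ℕ.<⇒≤pred 1<p)}})
                    (≡.cong ℕ.pred (≡.sym (ℕ.*-identityˡ p)))
    top : coeff f (suc (ℕ.pred (ℕ.pred p))) ≈ 1#
    top = begin
      coeff f (suc (ℕ.pred (ℕ.pred p)))
        ≈⟨ coeff-+ (1# ∷ []) (powerSumPoly (suc n) (1 ℕ.* p)) (suc (ℕ.pred (ℕ.pred p))) ⟩
      0# + coeff (powerSumPoly (suc n) (1 ℕ.* p)) (suc (ℕ.pred (ℕ.pred p)))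
        ≈⟨ +-identityˡ _ ⟩
      coeff (powerSumPoly (suc n) (1 ℕ.* p)) (suc (ℕ.pred (ℕ.pred p)))
        ≡⟨ ≡.cong (coeff (powerSumPoly (suc n) (1 ℕ.* p))) index ⟩
      coeff (powerSumPoly (suc n) (1 ℕ.* p)) (ℕ.pred (1 ℕ.* p))
        ≈⟨ coeff-powerSumPoly-pred n 0<1*p ⟩
      1# ∎
  ... | x , fx≈0 = x ,
    (λ x≈0 → 1≉0 (trans (sym (coeff-powerSumPoly-pred (suc n) {1} (s≤s z≤n)))
                   (trans (sym (eval-zero (powerSumPoly (suc (suc n)) 1) x≈0)) fx≈0))) ,
    (begin
      powerSum p (suc (suc n)) x
        ≈⟨ powerSum-cong p (suc (suc n)) (sym (*-identityʳ x)) ⟩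
      powerSum p (suc (suc n)) (x ^ 1)
        ≈⟨ eval-powerSumPoly (suc (suc n)) {1} (s≤s z≤n) x ⟨
      x * eval (powerSumPoly (suc (suc n)) 1) x
        ≈⟨ *-congˡ fx≈0 ⟩
      x * 0#
        ≈⟨ zeroʳ x ⟩
      0# ∎)

  -- Raising ζ^p = ζ + x to the p-th power gives the same relation between ζ^p and x^p, so the
  -- increments x, x^p, ... accumulate.
  frobenius-iterate : ∀ j {ζ x} → ζ ^ p ≈ ζ + x → ζ ^ (p ℕ.^ j) ≈ ζ + powerSum p j x
  frobenius-iterate zero    {ζ} {x} eq = trans (*-identityʳ ζ) (sym (+-identityʳ ζ))
  frobenius-iterate (suc j) {ζ} {x} eq = begin
    ζ ^ (p ℕ.* p ℕ.^ j)                ≈⟨ ^-assocʳ ζ p (p ℕ.^ j) ⟨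
    (ζ ^ p) ^ (p ℕ.^ j)                ≈⟨ frobenius-iterate j
                                            (trans (^-congˡ p eq) (frobenius-+ pr p·1≈0 ζ x)) ⟩
    ζ ^ p + powerSum p j (x ^ p)       ≈⟨ +-congʳ eq ⟩
    ζ + x + powerSum p j (x ^ p)       ≈⟨ +-assoc _ _ _ ⟩
    ζ + (x + powerSum p j (x ^ p))     ∎

  -- As in the additive form of Hilbert 90, an x of trace zero is a difference ζ^p - ζ with ζ fixed
  -- by the n-th iterate of Frobenius; x nonzero keeps ζ out of the prime field.
  non-prime-element : ∀ {n} → 1 ℕ.< n → ∃[ ζ ] ζ ^ (p ℕ.^ n) ≈ ζ × ¬ ζ ^ p ≈ ζ
  non-prime-element {n} 1<n with powerSum-root 1<n
  ... | x , x≉0 , Sx≈0 with affine-root 1<p x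
  ...   | ζ , ζᵖ≈ζ+x = ζ ,
    trans (frobenius-iterate n ζᵖ≈ζ+x) (trans (+-congˡ Sx≈0) (+-identityʳ ζ)) ,
    λ ζᵖ≈ζ → x≉0 (∙-cancelˡ ζ x 0# (trans (sym ζᵖ≈ζ+x) (trans ζᵖ≈ζ (sym (+-identityʳ ζ)))))

  module Orbit {ζ n} (fixed : ζ ^ (p ℕ.^ n) ≈ ζ) (moved : ¬ ζ ^ p ≈ ζ) where

    ^-p^-+ : ∀ x i j → x ^ (p ℕ.^ (i ℕ.+ j)) ≈ (x ^ (p ℕ.^ i)) ^ (p ℕ.^ j)
    ^-p^-+ x i j = trans (^-congʳ x (ℕ.^-distribˡ-+-* p i j)) (sym (^-assocʳ x (p ℕ.^ i) (p ℕ.^ j)))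

    fixed-* : ∀ {d} → ζ ^ (p ℕ.^ d) ≈ ζ → ∀ m → ζ ^ (p ℕ.^ (m ℕ.* d)) ≈ ζ
    fixed-* {d} eq zero    = *-identityʳ ζ
    fixed-* {d} eq (suc m) = begin
      ζ ^ (p ℕ.^ (d ℕ.+ m ℕ.* d))              ≈⟨ ^-p^-+ ζ d (m ℕ.* d) ⟩
      (ζ ^ (p ℕ.^ d)) ^ (p ℕ.^ (m ℕ.* d))      ≈⟨ ^-congˡ (p ℕ.^ (m ℕ.* d)) eq ⟩
      ζ ^ (p ℕ.^ (m ℕ.* d))                    ≈⟨ fixed-* eq m ⟩
      ζ                                        ∎

    conjugate : ℕ → Carrier
    conjugate i = ζ ^ (p ℕ.^ i)

    conjugate-fixed : ∀ i → conjugate i ^ (p ℕ.^ n) ≈ conjugate i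
    conjugate-fixed i = begin
      conjugate i ^ (p ℕ.^ n)         ≈⟨ ^-p^-+ ζ i n ⟨
      ζ ^ (p ℕ.^ (i ℕ.+ n))           ≈⟨ ^-congʳ ζ (≡.cong (p ℕ.^_) (ℕ.+-comm i n)) ⟩
      ζ ^ (p ℕ.^ (n ℕ.+ i))           ≈⟨ ^-p^-+ ζ n i ⟩
      (ζ ^ (p ℕ.^ n)) ^ (p ℕ.^ i)     ≈⟨ ^-congˡ (p ℕ.^ i) fixed ⟩
      conjugate i                     ∎

    -- Frobenius is undone by going on: n is a period, so i n - i further steps carry `conjugate i`
    -- back to ζ and `conjugate (i + d)` to `conjugate d`.
    conjugate-period : 0 ℕ.< n → ∀ i d → conjugate i ≈ conjugate (i ℕ.+ d) → ζ ^ (p ℕ.^ d) ≈ ζ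
    conjugate-period 0<n i d eq = begin
      ζ ^ (p ℕ.^ d)                              ≈⟨ ^-congˡ (p ℕ.^ d) (fixed-* fixed i) ⟨
      (ζ ^ (p ℕ.^ (i ℕ.* n))) ^ (p ℕ.^ d)        ≈⟨ ^-p^-+ ζ (i ℕ.* n) d ⟨
      ζ ^ (p ℕ.^ (i ℕ.* n ℕ.+ d))                ≈⟨ ^-congʳ ζ (≡.cong (p ℕ.^_) rearrange) ⟩
      ζ ^ (p ℕ.^ (i ℕ.+ d ℕ.+ e))                ≈⟨ ^-p^-+ ζ (i ℕ.+ d) e ⟩
      conjugate (i ℕ.+ d) ^ (p ℕ.^ e)            ≈⟨ ^-congˡ (p ℕ.^ e) eq ⟨
      conjugate i ^ (p ℕ.^ e)                    ≈⟨ ^-p^-+ ζ i e ⟨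
      ζ ^ (p ℕ.^ (i ℕ.+ e))                      ≈⟨ ^-congʳ ζ (≡.cong (p ℕ.^_) (ℕ.m+[n∸m]≡n i≤i*n)) ⟩
      ζ ^ (p ℕ.^ (i ℕ.* n))                      ≈⟨ fixed-* fixed i ⟩
      ζ                                          ∎
      where
      i≤i*n : i ℕ.≤ i ℕ.* n
      i≤i*n = ℕ.m≤m*n i n {{ℕ.>-nonZero 0<n}}
      e : ℕ
      e = i ℕ.* n ℕ.∸ i
      rearrange : i ℕ.* n ℕ.+ d ≡ i ℕ.+ d ℕ.+ e
      rearrange = ≡.trans (≡.cong (ℕ._+ d) (≡.sym (ℕ.m+[n∸m]≡n i≤i*n)))
        (solve-ℕ 3 (λ i e d → i ⊕ e ⊕ d ⊜ i ⊕ d ⊕ e) ≡.refl i e d)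
        where open ℕ.+-*-Solver renaming (solve to solve-ℕ; _:+_ to _⊕_; _:=_ to _⊜_)

    -- If n ≡ 1 modulo a period d of the Frobenius orbit of ζ, then ζ = ζ^(pⁿ) = ζ^p.
    aperiodic : ∀ {d} → 0 ℕ.< n → d ∣ ℕ.pred n → ¬ ζ ^ (p ℕ.^ d) ≈ ζ
    aperiodic {d} 0<n (divides m eq) period = moved (begin
      ζ ^ p                                        ≈⟨ ^-congˡ p (fixed-* period m) ⟨
      (ζ ^ (p ℕ.^ (m ℕ.* d))) ^ p                  ≈⟨ ^-assocʳ ζ (p ℕ.^ (m ℕ.* d)) p ⟩
      ζ ^ (p ℕ.^ (m ℕ.* d) ℕ.* p)                  ≈⟨ ^-congʳ ζ exponent ⟩
      ζ ^ (p ℕ.^ n)                                ≈⟨ fixed ⟩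
      ζ                                            ∎)
      where
      exponent : p ℕ.^ (m ℕ.* d) ℕ.* p ≡ p ℕ.^ n
      exponent = ≡.trans (ℕ.*-comm _ p) (≡.cong (p ℕ.^_)
        (≡.trans (≡.cong suc (≡.sym eq)) (ℕ.suc-pred n {{ℕ.>-nonZero 0<n}})))

  -- The gap between two indices is positive and below N, hence a divisor of n - 1 by hypothesis,
  -- and `aperiodic` excludes it as a period.
  frobenius-fixed-nodes : ∀ N {n} → 1 ℕ.< n → (∀ {d} → 0 ℕ.< d → d ℕ.< N → d ∣ ℕ.pred n) →
    Σ (Vector Carrier N) λ b → (∀ {i j} → b i ≈ b j → i ≡ j) × (∀ i → b i ^ (p ℕ.^ n) ≈ b i)
  frobenius-fixed-nodes N {n} 1<n div with non-prime-element 1<n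
  ... | ζ , fixed , moved = conjugate ∘ toℕ , injective , λ i → conjugate-fixed (toℕ i)
    where
    open Orbit {ζ} {n} fixed moved
    0<n : 0 ℕ.< n
    0<n = ℕ.<-trans (s≤s z≤n) 1<n
    distinct : ∀ {i j} → i ℕ.< j → j ℕ.< N → ¬ conjugate i ≈ conjugate j
    distinct {i} {j} i<j j<N eq = aperiodic 0<n
      (div (ℕ.m<n⇒0<n∸m i<j) (ℕ.≤-<-trans (ℕ.m∸n≤m j i) j<N))
      (conjugate-period 0<n i (j ℕ.∸ i)
        (trans eq (^-congʳ ζ (≡.cong (p ℕ.^_) (≡.sym (ℕ.m+[n∸m]≡n (ℕ.<⇒≤ i<j)))))))
    injective : ∀ {i j : Fin N} → conjugate (toℕ i) ≈ conjugate (toℕ j) → i ≡ j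
    injective {i} {j} eq with ℕ.<-cmp (toℕ i) (toℕ j)
    ... | tri< i<j _ _ = contradiction eq (distinct i<j (toℕ<n j))
    ... | tri≈ _ i≡j _ = toℕ-injective i≡j
    ... | tri> _ _ j<i = contradiction (sym eq) (distinct j<i (toℕ<n i))

-- Representing polynomials by powers

-- ∑_{i<j} (p - 1) Qⁱ
repdigit : ℕ → ℕ → ℕ → ℕ
repdigit p Q zero    = 0
repdigit p Q (suc j) = ℕ.pred p ℕ.+ Q ℕ.* repdigit p Q j

-- Only the residue of the base modulo k matters, as the digits do not change; w collects the
-- multiples of k.
repdigit-cong : ∀ {k} p u j → ∃[ w ] repdigit p (p ℕ.+ u ℕ.* k) j ≡ repdigit p p j ℕ.+ w ℕ.* k
repdigit-cong     p u zero    = 0 , ≡.refl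
repdigit-cong {k} p u (suc j) with repdigit-cong {k} p u j
... | w , eq = u ℕ.* (K ℕ.+ w ℕ.* k) ℕ.+ p ℕ.* w , ≡.trans
  (≡.cong (λ t → ℕ.pred p ℕ.+ (p ℕ.+ u ℕ.* k) ℕ.* t) eq)
  (solve 6 (λ d p u k K w → d :+ (p :+ u :* k) :* (K :+ w :* k) :=
     d :+ p :* K :+ (u :* (K :+ w :* k) :+ p :* w) :* k) ≡.refl (ℕ.pred p) p u k K w)
  where
  open ℕ.+-*-Solver
  K = repdigit p p j

suc-repdigit : ∀ p .{{_ : ℕ.NonZero p}} j → suc (repdigit p p j) ≡ p ℕ.^ j
suc-repdigit p zero    = ≡.refl
suc-repdigit p (suc j) = begin
  suc (ℕ.pred p) ℕ.+ p ℕ.* repdigit p p j    ≡⟨ ≡.cong (ℕ._+ p ℕ.* repdigit p p j) (ℕ.suc-pred p) ⟩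
  p ℕ.+ p ℕ.* repdigit p p j                 ≡⟨ ℕ.*-suc p (repdigit p p j) ⟨
  p ℕ.* suc (repdigit p p j)                 ≡⟨ ≡.cong (p ℕ.*_) (suc-repdigit p j) ⟩
  p ℕ.* p ℕ.^ j                              ∎
  where open ≡.≡-Reasoning

suc-^ : ∀ k m → ∃[ u ] suc k ℕ.^ m ≡ 1 ℕ.+ u ℕ.* k
suc-^ k zero    = 0 , ≡.refl
suc-^ k (suc m) with suc-^ k m
... | u , eq = suc (u ℕ.* suc k) , ≡.trans (≡.cong (suc k ℕ.*_) eq)
  (solve 2 (λ k u → (con 1 :+ k) :* (con 1 :+ u :* k) :=
     con 1 :+ (con 1 :+ u :* (con 1 :+ k)) :* k) ≡.refl k u)
  where open ℕ.+-*-Solver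

-- p^n ≡ p modulo p^r - 1 when n ≡ 1 modulo r.
p^r∸1∣repdigit : ∀ p .{{_ : ℕ.NonZero p}} r {n} → r ∣ n → p ℕ.^ r ℕ.∸ 1 ∣ repdigit p (p ℕ.^ suc n) r
p^r∸1∣repdigit p r {n} (divides m ≡.refl) = divides (suc w) (begin
  repdigit p (p ℕ.* p ℕ.^ (m ℕ.* r)) r     ≡⟨ ≡.cong (λ t → repdigit p t r) exponent ⟩
  repdigit p (p ℕ.+ p ℕ.* u ℕ.* k) r       ≡⟨ proj₂ (repdigit-cong p (p ℕ.* u) r) ⟩
  repdigit p p r ℕ.+ w ℕ.* k               ≡⟨ ≡.cong (ℕ._+ w ℕ.* k) K≡k ⟩
  suc w ℕ.* k                              ∎)
  where
  open ≡.≡-Reasoning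
  k = p ℕ.^ r ℕ.∸ 1
  u = proj₁ (suc-^ k m)
  w = proj₁ (repdigit-cong {k} p (p ℕ.* u) r)
  K≡k : repdigit p p r ≡ k
  K≡k = ≡.cong ℕ.pred (suc-repdigit p r)
  suc-k : suc k ≡ p ℕ.^ r
  suc-k = ≡.trans (≡.cong suc (≡.sym K≡k)) (suc-repdigit p r)
  exponent : p ℕ.* p ℕ.^ (m ℕ.* r) ≡ p ℕ.+ p ℕ.* u ℕ.* k
  exponent = begin
    p ℕ.* p ℕ.^ (m ℕ.* r)      ≡⟨ ≡.cong (λ t → p ℕ.* p ℕ.^ t) (ℕ.*-comm m r) ⟩
    p ℕ.* p ℕ.^ (r ℕ.* m)      ≡⟨ ≡.cong (p ℕ.*_) (ℕ.^-*-assoc p r m) ⟨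
    p ℕ.* (p ℕ.^ r) ℕ.^ m      ≡⟨ ≡.cong (λ t → p ℕ.* t ℕ.^ m) suc-k ⟨
    p ℕ.* suc k ℕ.^ m          ≡⟨ ≡.cong (p ℕ.*_) (proj₂ (suc-^ k m)) ⟩
    p ℕ.* (1 ℕ.+ u ℕ.* k)      ≡⟨ ℕ.*-suc p (u ℕ.* k) ⟩
    p ℕ.+ p ℕ.* (u ℕ.* k)      ≡⟨ ≡.cong (p ℕ.+_) (ℕ.*-assoc p u k) ⟨
    p ℕ.+ p ℕ.* u ℕ.* k        ∎

m∣n! : ∀ {m n} → 0 ℕ.< m → m ℕ.≤ n → m ∣ n !
m∣n! {suc m} _ m≤n = ∣-trans (m∣m*n (m !)) (m≤n⇒m!∣n! m≤n)

module Representation {c ℓ} (R : CommutativeRing c ℓ)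
  (closed : PolynomialProperties.HasRoots R)
  (inverse : PolynomialProperties.HasInverses R)
  (1≉0 : ¬ CommutativeRing._≈_ R (CommutativeRing.1# R) (CommutativeRing.0# R))
  {p} (pr : Prime p)
  (p·1≈0 : CommutativeRing._≈_ R (Mult._×_ (CommutativeRing.semiring R) p (CommutativeRing.1# R))
                                 (CommutativeRing.0# R)) where

  open CommutativeRing R hiding (zero)
  open Polynomial R
  open PolynomialProperties R
  open Frobenius R
  open Roots R closed 1≉0 pr p·1≈0
  open import Algebra.Properties.CommutativeSemiring.Exp commutativeSemiring
  open import Algebra.Properties.Semiring.Sum semiring
  open Mult semiring using () renaming (_×_ to _·_)
  open import Algebra.Properties.Group +-group using (inverseˡ-unique)
  open import Algebra.Properties.Ring ring using (-‿distribˡ-*; -‿distribʳ-*; -‿involutive; +-cancelʳ)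
  open import Algebra.Solver.Ring.NaturalCoefficients.Default commutativeSemiring
    using (solve; _:=_; _:+_; _:*_; con)
  open import Relation.Binary.Reasoning.Setoid setoid

  instance
    p≢0 : ℕ.NonZero p
    p≢0 = prime⇒nonZero pr

  1^n≈1 : ∀ n → 1# ^ n ≈ 1#
  1^n≈1 zero    = refl
  1^n≈1 (suc n) = trans (*-identityˡ _) (1^n≈1 n)

  -- (1 + x X)ᵐ f
  mulPower : ℕ → Carrier → Poly → Poly
  mulPower zero    x f = f
  mulPower (suc m) x f = mulPower m x f +ₚ (0# ∷ map (x *_) (mulPower m x f))

  length-mulPower : ∀ m x f {n} → length f ℕ.≤ n → length (mulPower m x f) ℕ.≤ m ℕ.+ n
  length-mulPower zero    x f l = l
  length-mulPower (suc m) x f {n} l = length-+ (mulPower m x f) _ (ℕ.m≤n⇒m≤1+n l′)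
    (s≤s (≡.subst (ℕ._≤ m ℕ.+ n) (≡.sym (length-map (x *_) (mulPower m x f))) l′))
    where l′ = length-mulPower m x f l

  eval-mulPower : ∀ m x f b → eval (mulPower m x f) b ≈ (1# + b * x) ^ m * eval f b
  eval-mulPower zero    x f b = sym (*-identityˡ _)
  eval-mulPower (suc m) x f b = begin
    eval (g +ₚ (0# ∷ map (x *_) g)) b
      ≈⟨ eval-+ g (0# ∷ map (x *_) g) b ⟩
    eval g b + (0# + b * eval (map (x *_) g) b)
      ≈⟨ +-congˡ (trans (+-identityˡ _) (*-congˡ (eval-scale x g b))) ⟩
    eval g b + b * (x * eval g b)
      ≈⟨ solve 3 (λ e b x → e :+ b :* (x :* e) := (con 1 :+ b :* x) :* e) refl (eval g b) b x ⟩
    (1# + b * x) * eval g b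
      ≈⟨ *-congˡ (eval-mulPower m x f b) ⟩
    (1# + b * x) * ((1# + b * x) ^ m * eval f b)
      ≈⟨ *-assoc _ _ _ ⟨
    (1# + b * x) ^ suc m * eval f b ∎
    where g = mulPower m x f

  coeff₀-mulPower : ∀ m x f → coeff (mulPower m x f) 0 ≈ coeff f 0
  coeff₀-mulPower zero    x f = refl
  coeff₀-mulPower (suc m) x f = trans (coeff-+ (mulPower m x f) _ 0)
    (trans (+-identityʳ _) (coeff₀-mulPower m x f))

  coeff₁-mulPower : ∀ m x f → coeff f 0 ≈ 1# → coeff (mulPower m x f) 1 ≈ m · x + coeff f 1
  coeff₁-mulPower zero    x f f₀≈1 = sym (+-identityˡ _)
  coeff₁-mulPower (suc m) x f f₀≈1 = begin
    coeff (mulPower (suc m) x f) 1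
      ≈⟨ coeff-+ (mulPower m x f) _ 1 ⟩
    coeff (mulPower m x f) 1 + coeff (map (x *_) (mulPower m x f)) 0
      ≈⟨ +-cong (coeff₁-mulPower m x f f₀≈1) (coeff-scale x (mulPower m x f) 0) ⟩
    m · x + coeff f 1 + x * coeff (mulPower m x f) 0
      ≈⟨ +-congˡ (trans (*-congˡ (trans (coeff₀-mulPower m x f) f₀≈1)) (*-identityʳ x)) ⟩
    m · x + coeff f 1 + x
      ≈⟨ +-comm _ x ⟩
    x + (m · x + coeff f 1)
      ≈⟨ +-assoc _ _ _ ⟨
    suc m · x + coeff f 1 ∎

  -- ∏_{i<j} (1 + x^(Qⁱ) X)^(p-1)
  frobeniusProduct : ℕ → ℕ → Carrier → Poly
  frobeniusProduct Q zero    x = 1# ∷ []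
  frobeniusProduct Q (suc j) x = mulPower (ℕ.pred p) x (frobeniusProduct Q j (x ^ Q))

  length-frobeniusProduct : ∀ Q j x → length (frobeniusProduct Q j x) ℕ.≤ j ℕ.* ℕ.pred p ℕ.+ 1
  length-frobeniusProduct Q zero    x = s≤s z≤n
  length-frobeniusProduct Q (suc j) x = ℕ.≤-trans
    (length-mulPower (ℕ.pred p) x _ (length-frobeniusProduct Q j (x ^ Q)))
    (ℕ.≤-reflexive (≡.sym (ℕ.+-assoc (ℕ.pred p) (j ℕ.* ℕ.pred p) 1)))

  coeff₀-frobeniusProduct : ∀ Q j x → coeff (frobeniusProduct Q j x) 0 ≈ 1#
  coeff₀-frobeniusProduct Q zero    x = refl
  coeff₀-frobeniusProduct Q (suc j) x = trans (coeff₀-mulPower (ℕ.pred p) x _)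
    (coeff₀-frobeniusProduct Q j (x ^ Q))

  pred·+ : ∀ x → ℕ.pred p · x + x ≈ 0#
  pred·+ x = trans (+-comm _ x) (trans (reflexive (≡.cong (_· x) (ℕ.suc-pred p))) (p·x≈0 {p} p·1≈0 x))

  -- All factors have constant term 1, so their linear coefficients add up, and p - 1 acts as -1 in
  -- characteristic p.
  coeff₁-frobeniusProduct : ∀ Q j x → coeff (frobeniusProduct Q j x) 1 ≈ - powerSum Q j x
  coeff₁-frobeniusProduct Q zero    x = inverseˡ-unique 0# 0# (+-identityˡ 0#)
  coeff₁-frobeniusProduct Q (suc j) x = begin
    coeff (frobeniusProduct Q (suc j) x) 1
      ≈⟨ coeff₁-mulPower (ℕ.pred p) x _ (coeff₀-frobeniusProduct Q j (x ^ Q)) ⟩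
    ℕ.pred p · x + coeff (frobeniusProduct Q j (x ^ Q)) 1
      ≈⟨ +-congˡ (coeff₁-frobeniusProduct Q j (x ^ Q)) ⟩
    ℕ.pred p · x + - S
      ≈⟨ inverseˡ-unique _ _ cancel ⟩
    - (x + S) ∎
    where
    S = powerSum Q j (x ^ Q)
    cancel : ℕ.pred p · x + - S + (x + S) ≈ 0#
    cancel = begin
      ℕ.pred p · x + - S + (x + S)        ≈⟨ solve 4 (λ a b c d → (a :+ b) :+ (c :+ d) := (a :+ c) :+ (b :+ d))
                                              refl (ℕ.pred p · x) (- S) x S ⟩
      (ℕ.pred p · x + x) + (- S + S)      ≈⟨ +-cong (pred·+ x) (-‿inverseˡ S) ⟩
      0# + 0#                             ≈⟨ +-identityˡ 0# ⟩
      0#                                  ∎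

  -- Since b^Q = b, Frobenius turns 1 + b x^Q into (1 + b x)^Q, so all factors become powers of the
  -- one base 1 + b x and the exponents add up to `repdigit`.
  eval-frobeniusProduct : ∀ {n b} → b ^ (p ℕ.^ n) ≈ b → ∀ j x →
    eval (frobeniusProduct (p ℕ.^ n) j x) b ≈ (1# + b * x) ^ repdigit p (p ℕ.^ n) j
  eval-frobeniusProduct         fixed zero    x = eval-const 1# _
  eval-frobeniusProduct {n} {b} fixed (suc j) x = begin
    eval (mulPower (ℕ.pred p) x (frobeniusProduct Q j (x ^ Q))) b
      ≈⟨ eval-mulPower (ℕ.pred p) x _ b ⟩
    (1# + b * x) ^ ℕ.pred p * eval (frobeniusProduct Q j (x ^ Q)) b
      ≈⟨ *-congˡ (eval-frobeniusProduct {n} fixed j (x ^ Q)) ⟩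
    (1# + b * x) ^ ℕ.pred p * (1# + b * x ^ Q) ^ repdigit p Q j
      ≈⟨ *-congˡ (^-congˡ (repdigit p Q j) frob) ⟨
    (1# + b * x) ^ ℕ.pred p * ((1# + b * x) ^ Q) ^ repdigit p Q j
      ≈⟨ *-congˡ (^-assocʳ (1# + b * x) Q (repdigit p Q j)) ⟩
    (1# + b * x) ^ ℕ.pred p * (1# + b * x) ^ (Q ℕ.* repdigit p Q j)
      ≈⟨ ^-homo-* (1# + b * x) (ℕ.pred p) (Q ℕ.* repdigit p Q j) ⟨
    (1# + b * x) ^ repdigit p Q (suc j) ∎
    where
    Q = p ℕ.^ n
    frob : (1# + b * x) ^ Q ≈ 1# + b * x ^ Q
    frob = begin
      (1# + b * x) ^ Q         ≈⟨ frobenius^-+ pr p·1≈0 n 1# (b * x) ⟩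
      1# ^ Q + (b * x) ^ Q     ≈⟨ +-cong (1^n≈1 Q) (^-distrib-* b x Q) ⟩
      1# + b ^ Q * x ^ Q       ≈⟨ +-congˡ (*-congʳ fixed) ⟩
      1# + b * x ^ Q           ∎

  -- Used twice: as interpolation nodes fixed by the power `Q`, and, through distinctness alone, as
  -- evidence that F is infinite.
  nodes : ∀ N → Σ (Vector Carrier N) λ b →
    (∀ {i j} → b i ≈ b j → i ≡ j) × (∀ i → b i ^ (p ℕ.^ suc (N !)) ≈ b i)
  nodes N = frobenius-fixed-nodes N (s≤s (ℕ.1≤n! N)) λ 0<d d<N → m∣n! 0<d (ℕ.<⇒≤ d<N)

  -- The target is a function on F, not a polynomial, so that sums, scalings and Frobenius are
  -- computed in F instead of on coefficient lists.
  Representable : ℕ → ℕ → (Carrier → Carrier) → Set (c ⊔ ℓ)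
  Representable k s φ = ∃[ gs ] length gs ℕ.≤ s × (∀ x → eval (sumₚ (map (_^ₚ k) gs)) x ≈ φ x)

  representable-+ : ∀ k {s t φ ψ} → Representable k s φ → Representable k t ψ →
    Representable k (s ℕ.+ t) (λ x → φ x + ψ x)
  representable-+ k {s} {t} {φ} {ψ} (fs , ls , f≈φ) (gs , lt , g≈ψ) =
    fs ++ gs , ≡.subst (ℕ._≤ s ℕ.+ t) (≡.sym (length-++ fs)) (ℕ.+-mono-≤ ls lt) , λ x → begin
      eval (sumₚ (map (_^ₚ k) (fs ++ gs))) x
        ≡⟨ ≡.cong (λ t → eval (sumₚ t) x) (map-++ (_^ₚ k) fs gs) ⟩
      eval (sumₚ (map (_^ₚ k) fs ++ map (_^ₚ k) gs)) x
        ≈⟨ eval-sum-++ (map (_^ₚ k) fs) (map (_^ₚ k) gs) x ⟩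
      eval (sumₚ (map (_^ₚ k) fs)) x + eval (sumₚ (map (_^ₚ k) gs)) x
        ≈⟨ +-cong (f≈φ x) (g≈ψ x) ⟩
      φ x + ψ x ∎

  eval-tabulate : ∀ k {N} (g : Fin N → Poly) x →
    eval (sumₚ (map (_^ₚ k) (tabulate g))) x ≈ ∑[ i < N ] (eval (g i) x ^ k)
  eval-tabulate k {zero}  g x = refl
  eval-tabulate k {suc N} g x = begin
    eval (g fzero ^ₚ k +ₚ sumₚ (map (_^ₚ k) (tabulate (g ∘ fsuc)))) x
      ≈⟨ eval-+ (g fzero ^ₚ k) _ x ⟩
    eval (g fzero ^ₚ k) x + eval (sumₚ (map (_^ₚ k) (tabulate (g ∘ fsuc)))) x
      ≈⟨ +-cong (eval-^ (g fzero) k x) (eval-tabulate k (g ∘ fsuc) x) ⟩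
    eval (g fzero) x ^ k + ∑[ i < N ] (eval (g (fsuc i)) x ^ k) ∎

  -- Each weight has a k-th root in F, which is absorbed into the polynomial being raised to the
  -- power k; weights therefore cost no extra summands.
  representable-∑ : ∀ {k N} → 0 ℕ.< k → (w : Vector Carrier N) (g : Fin N → Poly) →
    Representable k N (λ x → ∑[ i < N ] (w i * eval (g i) x ^ k))
  representable-∑ {k} {N} 0<k w g = tabulate h , ℕ.≤-reflexive (length-tabulate h) , λ x → begin
    eval (sumₚ (map (_^ₚ k) (tabulate h))) x    ≈⟨ eval-tabulate k h x ⟩
    ∑[ i < N ] (eval (h i) x ^ k)               ≈⟨ sum-cong-≋ {N} (step x) ⟩
    ∑[ i < N ] (w i * eval (g i) x ^ k)         ∎
    where
    root : ∀ i → ∃[ a ] a ^ k ≈ w i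
    root i = power-root 0<k (w i)
    h : Fin N → Poly
    h i = map (proj₁ (root i) *_) (g i)
    step : ∀ x i → eval (h i) x ^ k ≈ w i * eval (g i) x ^ k
    step x i = begin
      eval (h i) x ^ k                          ≈⟨ ^-congˡ k (eval-scale (proj₁ (root i)) (g i) x) ⟩
      (proj₁ (root i) * eval (g i) x) ^ k       ≈⟨ ^-distrib-* _ _ k ⟩
      proj₁ (root i) ^ k * eval (g i) x ^ k     ≈⟨ *-congʳ (proj₂ (root i)) ⟩
      w i * eval (g i) x ^ k                    ∎

  -- With B(y) = S(y) - S(y^Q) = y - y^(Q^r) and β^(Q^r) = β + 1, the terms of
  -- degree Q^r of (β + 1) B(y) and B(β y) coincide.
  frobenius-eliminate : ∀ Q r {β} → β ^ (Q ℕ.^ r) ≈ β + 1# → ∀ y → let S = powerSum Q r; γ = β + 1# in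
    γ * S y + (- γ * S (y ^ Q) + (- 1# * S (β * y) + 1# * S ((β * y) ^ Q))) ≈ y
  -- The added terms complete S(y) and S((β y)^Q) to sides of `powerSum-telescope`. The solver sees
  -- the negated scalars as independent variables; they cancel only in `annihilate`.
  frobenius-eliminate Q r {β} β^≈β+1 y = +-cancelʳ (γ * Y + β * y) _ _ (begin
    γ * S y + (- γ * S (y ^ Q) + (- 1# * S (β * y) + 1# * S ((β * y) ^ Q))) + (γ * Y + β * y)
      ≈⟨ solve 10 (λ γ s₁ u s₂ v s₃ s₄ Y β y →
           γ :* s₁ :+ (u :* s₂ :+ (v :* s₃ :+ con 1 :* s₄)) :+ (γ :* Y :+ β :* y) :=
           γ :* (s₁ :+ Y) :+ (u :* s₂ :+ v :* s₃) :+ (β :* y :+ s₄))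
         refl γ (S y) (- γ) (S (y ^ Q)) (- 1#) (S (β * y)) (S ((β * y) ^ Q)) Y β y ⟩
    γ * (S y + Y) + (- γ * S (y ^ Q) + - 1# * S (β * y)) + (β * y + S ((β * y) ^ Q))
      ≈⟨ +-cong (+-congʳ (*-congˡ (powerSum-telescope Q r y)))
           (sym (trans (+-congˡ (sym β-scale)) (powerSum-telescope Q r (β * y)))) ⟩
    γ * (y + S (y ^ Q)) + (- γ * S (y ^ Q) + - 1# * S (β * y)) + (S (β * y) + γ * Y)
      ≈⟨ solve 8 (λ γ y s₂ u v s₃ Y β →
           γ :* (y :+ s₂) :+ (u :* s₂ :+ v :* s₃) :+ (s₃ :+ γ :* Y) :=
           (γ :* y :+ γ :* Y) :+ ((γ :+ u) :* s₂ :+ (con 1 :+ v) :* s₃))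
         refl γ y (S (y ^ Q)) (- γ) (- 1#) (S (β * y)) Y β ⟩
    (γ * y + γ * Y) + ((γ + - γ) * S (y ^ Q) + (1# + - 1#) * S (β * y))
      ≈⟨ +-congˡ (+-cong (annihilate (-‿inverseʳ γ)) (annihilate (-‿inverseʳ 1#))) ⟩
    (γ * y + γ * Y) + (0# + 0#)
      ≈⟨ trans (+-congˡ (+-identityˡ 0#)) (+-identityʳ _) ⟩
    γ * y + γ * Y
      ≈⟨ +-congʳ (trans (distribʳ y β 1#) (trans (+-comm _ _) (+-congʳ (*-identityˡ y)))) ⟩
    y + β * y + γ * Y
      ≈⟨ trans (+-assoc _ _ _) (+-congˡ (+-comm _ _)) ⟩
    y + (γ * Y + β * y) ∎)
    where
    S : Carrier → Carrier
    S = powerSum Q r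
    γ Y : Carrier
    γ = β + 1#
    Y = y ^ (Q ℕ.^ r)
    β-scale : (β * y) ^ (Q ℕ.^ r) ≈ γ * Y
    β-scale = trans (^-distrib-* β y (Q ℕ.^ r)) (*-congʳ β^≈β+1)
    annihilate : ∀ {a b} → a ≈ 0# → a * b ≈ 0#
    annihilate a≈0 = trans (*-congʳ a≈0) (zeroˡ _)

  -- The four copies of N come from S at f, f^Q, β f and (β f)^Q, all of which are again values of S
  -- at polynomials.
  representable-id : ∀ {k N Q r} → 1 ℕ.< Q ℕ.^ r →
    (∀ a f → Representable k N (λ x → a * powerSum Q r (eval f x))) →
    ∀ f → Representable k (N ℕ.+ (N ℕ.+ (N ℕ.+ N))) (eval f)
  representable-id {k} {N} {Q} {r} 1<Q^r representable-powerSum f with affine-root 1<Q^r 1#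
  ... | β , β^≈β+1 = gs , l , λ x → trans (eq x) (combine x)
    where
    γ : Carrier
    γ = β + 1#
    βf : Poly
    βf = map (β *_) f
    S : Carrier → Carrier
    S = powerSum Q r
    all = representable-+ k (representable-powerSum γ f)
         (representable-+ k (representable-powerSum (- γ) (f ^ₚ Q))
         (representable-+ k (representable-powerSum (- 1#) βf)
                          (representable-powerSum 1# (βf ^ₚ Q))))
    gs = proj₁ all
    l  = proj₁ (proj₂ all)
    eq = proj₂ (proj₂ all)

    combine : ∀ x → γ * S (eval f x) + (- γ * S (eval (f ^ₚ Q) x) +
      (- 1# * S (eval βf x) + 1# * S (eval (βf ^ₚ Q) x))) ≈ eval f x
    combine x = trans (+-congˡ (+-cong (*-congˡ (S-cong (eval-^ f Q x)))
      (+-cong (*-congˡ (S-cong (eval-scale β f x)))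
              (*-congˡ (S-cong (trans (eval-^ βf Q x) (^-congˡ Q (eval-scale β f x))))))))
      (frobenius-eliminate Q r β^≈β+1 (eval f x))
      where
      S-cong : ∀ {x y} → x ≈ y → S x ≈ S y
      S-cong = powerSum-cong Q r

  module _ {r} (0<r : 0 ℕ.< r) where

    N k Q : ℕ
    N = r ℕ.* ℕ.pred p ℕ.+ 1
    k = p ℕ.^ r ℕ.∸ 1
    Q = p ℕ.^ suc (N !)

    -- Makes r a divisor of N!, so the exponent N! + 1 chosen for the nodes is also 1 modulo r.
    r≤N : r ℕ.≤ N
    r≤N = ℕ.≤-trans (ℕ.m≤m*n r (ℕ.pred p) {{ℕ.>-nonZero (ℕ.<⇒≤pred 1<p)}}) (ℕ.m≤m+n _ 1)

    0<k : 0 ℕ.< k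
    0<k = ℕ.m<n⇒0<n∸m (ℕ.<-≤-trans 1<p (≡.subst (ℕ._≤ p ℕ.^ r) (ℕ.^-identityʳ p) (ℕ.^-monoʳ-≤ p 0<r)))

    representable-powerSum : ∀ a f → Representable k N (λ x → a * powerSum Q r (eval f x))
    representable-powerSum a f with nodes N | p^r∸1∣repdigit p r (m∣n! 0<r r≤N)
    ... | b , b-inj , b-fixed | divides e K≡e*k with interpolable-coeff inverse b b-inj 1
    ...   | w , coeff₁≈ = gs , l , λ x → trans (eq x) (sym (target x))
      where
      g : Fin N → Poly
      -- As K = e k, the k-th power of this polynomial is the K-th power of 1 + b f.
      g i = ((1# ∷ []) +ₚ map (b i *_) f) ^ₚ e

      -- The sign compensates for the linear coefficient being -S.
      powers = representable-∑ 0<k (λ i → (- a) * w i) g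
      gs = proj₁ powers
      l  = proj₁ (proj₂ powers)
      eq = proj₂ (proj₂ powers)

      eval-g : ∀ x i → eval (g i) x ^ k ≈ eval (frobeniusProduct Q r (eval f x)) (b i)
      eval-g x i = begin
        eval (g i) x ^ k                                        ≈⟨ ^-congˡ k (eval-^ _ e x) ⟩
        (eval ((1# ∷ []) +ₚ map (b i *_) f) x ^ e) ^ k          ≈⟨ ^-assocʳ _ e k ⟩
        eval ((1# ∷ []) +ₚ map (b i *_) f) x ^ (e ℕ.* k)        ≈⟨ ^-cong base (≡.sym K≡e*k) ⟩
        (1# + b i * eval f x) ^ repdigit p Q r                  ≈⟨ eval-frobeniusProduct {suc (N !)} (b-fixed i) r (eval f x) ⟨
        eval (frobeniusProduct Q r (eval f x)) (b i)            ∎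
        where
        base : eval ((1# ∷ []) +ₚ map (b i *_) f) x ≈ 1# + b i * eval f x
        base = trans (eval-+ (1# ∷ []) (map (b i *_) f) x)
                     (+-cong (eval-const 1# x) (eval-scale (b i) f x))

      target : ∀ x → a * powerSum Q r (eval f x) ≈ ∑[ i < N ] ((- a) * w i * eval (g i) x ^ k)
      target x = begin
        a * S
          ≈⟨ neg-neg ⟩
        (- a) * (- S)
          ≈⟨ *-congˡ (coeff₁-frobeniusProduct Q r (eval f x)) ⟨
        (- a) * coeff P 1
          ≈⟨ *-congˡ (coeff₁≈ P (length-frobeniusProduct Q r (eval f x))) ⟩
        (- a) * ∑[ i < N ] (w i * eval P (b i))
          ≈⟨ *-distribˡ-sum (- a) (λ i → w i * eval P (b i)) ⟩
        ∑[ i < N ] ((- a) * (w i * eval P (b i)))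
          ≈⟨ sum-cong-≋ {N} (λ i → trans (sym (*-assoc (- a) (w i) (eval P (b i))))
                                         (*-congˡ (sym (eval-g x i)))) ⟩
        ∑[ i < N ] ((- a) * w i * eval (g i) x ^ k) ∎
        where
        S = powerSum Q r (eval f x)
        P = frobeniusProduct Q r (eval f x)
        neg-neg : a * S ≈ (- a) * (- S)
        neg-neg = begin
          a * S          ≈⟨ -‿involutive (a * S) ⟨
          - (- (a * S))  ≈⟨ -‿cong (-‿distribʳ-* a S) ⟩
          - (a * - S)    ≈⟨ -‿distribˡ-* a (- S) ⟩
          (- a) * (- S)  ∎

    1<Q^r : 1 ℕ.< Q ℕ.^ r
    1<Q^r = ≡.subst (1 ℕ.<_) (≡.sym (ℕ.^-*-assoc p (suc (N !)) r))
      (ℕ.<-≤-trans 1<p (≡.subst (ℕ._≤ p ℕ.^ (suc (N !) ℕ.* r)) (ℕ.^-identityʳ p)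
        (ℕ.^-monoʳ-≤ p (ℕ.*-mono-< {0} {suc (N !)} (s≤s z≤n) 0<r))))

    sum-of-powers : ∀ f → ∃[ gs ] length gs ℕ.≤ N ℕ.+ (N ℕ.+ (N ℕ.+ N)) × sumₚ (map (_^ₚ k) gs) ≈ₚ f
    sum-of-powers f = proj₁ powers , proj₁ (proj₂ powers) ,
      evals-≈⇒≈ₚ inverse (λ N → proj₁ (nodes N) , proj₁ (proj₂ (nodes N)))
        (sumₚ (map (_^ₚ k) (proj₁ powers))) f (proj₂ (proj₂ powers))
      where
      powers : Representable k (N ℕ.+ (N ℕ.+ (N ℕ.+ N))) (eval f)
      powers = representable-id {k} {N} {Q} {r} 1<Q^r representable-powerSum f

-- Lower bounds for logarithms and exponentials

ι : ℕ → ℚ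
ι n = ℤ.+ n / 1

toℚᵘ-ι : ∀ n → toℚᵘ (ι n) ℚᵘ.≃ ℚᵘ.mkℚᵘ (ℤ.+ n) 0
toℚᵘ-ι n = ℚ.toℚᵘ-fromℚᵘ (ℚᵘ.mkℚᵘ (ℤ.+ n) 0)

ι-+ : ∀ m n → ι (m ℕ.+ n) ≡ ι m ℚ.+ ι n
ι-+ m n = ℚ.toℚᵘ-injective (begin
  toℚᵘ (ι (m ℕ.+ n))                                 ≈⟨ toℚᵘ-ι (m ℕ.+ n) ⟩
  ℚᵘ.mkℚᵘ (ℤ.+ (m ℕ.+ n)) 0                          ≈⟨ ℚᵘ.*≡* (≡.cong (ℤ._* ℤ.+ 1) (≡.sym
                                                          (≡.cong₂ ℤ._+_ (ℤ.*-identityʳ (ℤ.+ m)) (ℤ.*-identityʳ (ℤ.+ n))))) ⟩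
  ℚᵘ.mkℚᵘ (ℤ.+ m) 0 ℚᵘ.+ ℚᵘ.mkℚᵘ (ℤ.+ n) 0           ≈⟨ ℚᵘ.+-cong (toℚᵘ-ι m) (toℚᵘ-ι n) ⟨
  toℚᵘ (ι m) ℚᵘ.+ toℚᵘ (ι n)                         ≈⟨ ℚ.toℚᵘ-homo-+ (ι m) (ι n) ⟨
  toℚᵘ (ι m ℚ.+ ι n)                                 ∎)
  where open ℚᵘ.≃-Reasoning

ι-* : ∀ m n → ι (m ℕ.* n) ≡ ι m ℚ.* ι n
ι-* m n = ℚ.toℚᵘ-injective (begin
  toℚᵘ (ι (m ℕ.* n))                                 ≈⟨ toℚᵘ-ι (m ℕ.* n) ⟩
  ℚᵘ.mkℚᵘ (ℤ.+ (m ℕ.* n)) 0                          ≈⟨ ℚᵘ.*≡* (≡.cong (ℤ._* ℤ.+ 1) (ℤ.pos-* m n)) ⟩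
  ℚᵘ.mkℚᵘ (ℤ.+ m) 0 ℚᵘ.* ℚᵘ.mkℚᵘ (ℤ.+ n) 0           ≈⟨ ℚᵘ.*-cong (toℚᵘ-ι m) (toℚᵘ-ι n) ⟨
  toℚᵘ (ι m) ℚᵘ.* toℚᵘ (ι n)                         ≈⟨ ℚ.toℚᵘ-homo-* (ι m) (ι n) ⟨
  toℚᵘ (ι m ℚ.* ι n)                                 ∎)
  where open ℚᵘ.≃-Reasoning

0≤ι : ∀ n → 0ℚ ℚ.≤ ι n
0≤ι n = ℚ.nonNegative⁻¹ (ι n) {{ℚ.normalize-nonNeg n 1}}

ι-pos : ∀ n .{{_ : ℕ.NonZero n}} → ℚ.Positive (ι n)
ι-pos n = ℚ.normalize-pos n 1

ι-mono : ∀ {m n} → m ℕ.≤ n → ι m ℚ.≤ ι n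
ι-mono {m} {n} m≤n = begin
  ι m                       ≡⟨ ℚ.+-identityʳ (ι m) ⟨
  ι m ℚ.+ 0ℚ                ≤⟨ ℚ.+-monoʳ-≤ (ι m) (0≤ι (n ℕ.∸ m)) ⟩
  ι m ℚ.+ ι (n ℕ.∸ m)       ≡⟨ ι-+ m (n ℕ.∸ m) ⟨
  ι (m ℕ.+ (n ℕ.∸ m))       ≡⟨ ≡.cong ι (ℕ.m+[n∸m]≡n m≤n) ⟩
  ι n                       ∎
  where open ℚ.≤-Reasoning

*-monoˡ : ∀ {r p q} → 0ℚ ℚ.≤ r → p ℚ.≤ q → r ℚ.* p ℚ.≤ r ℚ.* q
*-monoˡ {r} 0≤r = ℚ.*-monoˡ-≤-nonNeg r {{nonNegative 0≤r}}

*-monoʳ : ∀ {r p q} → 0ℚ ℚ.≤ r → p ℚ.≤ q → p ℚ.* r ℚ.≤ q ℚ.* r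
*-monoʳ {r} 0≤r = ℚ.*-monoʳ-≤-nonNeg r {{nonNegative 0≤r}}

*-mono : ∀ {p q r s} → 0ℚ ℚ.≤ p → 0ℚ ℚ.≤ r → p ℚ.≤ q → r ℚ.≤ s → p ℚ.* r ℚ.≤ q ℚ.* s
*-mono 0≤p 0≤r p≤q r≤s = ℚ.≤-trans (*-monoʳ 0≤r p≤q) (*-monoˡ (ℚ.≤-trans 0≤p p≤q) r≤s)

0≤* : ∀ {p q} → 0ℚ ℚ.≤ p → 0ℚ ℚ.≤ q → 0ℚ ℚ.≤ p ℚ.* q
0≤* {p} {q} 0≤p 0≤q = ≡.subst (ℚ._≤ p ℚ.* q) (ℚ.*-zeroʳ p) (*-monoˡ 0≤p 0≤q)

p≤p+q : ∀ {p q} → 0ℚ ℚ.≤ q → p ℚ.≤ p ℚ.+ q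
p≤p+q {p} {q} 0≤q = ≡.subst (ℚ._≤ p ℚ.+ q) (ℚ.+-identityʳ p) (ℚ.+-monoʳ-≤ p 0≤q)

+-cancelˡ-≤ : ∀ r {p q} → r ℚ.+ p ℚ.≤ r ℚ.+ q → p ℚ.≤ q
+-cancelˡ-≤ r {p} {q} r+p≤r+q = ≡.subst₂ ℚ._≤_ (cancel p) (cancel q) (ℚ.+-monoʳ-≤ (ℚ.- r) r+p≤r+q)
  where
  open ℚ.+-*-Solver
  cancel : ∀ t → ℚ.- r ℚ.+ (r ℚ.+ t) ≡ t
  cancel t = solve 2 (λ r t → :- r :+ (r :+ t) := t) ≡.refl r t

recip : ℕ → ℚ
recip i = ℤ.+ 1 / suc i

0≤recip : ∀ i → 0ℚ ℚ.≤ recip i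
0≤recip i = ℚ.nonNegative⁻¹ (recip i) {{ℚ.normalize-nonNeg 1 (suc i)}}

ι*recip : ∀ i → ι (suc i) ℚ.* recip i ≡ 1ℚ
ι*recip i = ℚ.toℚᵘ-injective (begin
  toℚᵘ (ι (suc i) ℚ.* recip i)                   ≈⟨ ℚ.toℚᵘ-homo-* (ι (suc i)) (recip i) ⟩
  toℚᵘ (ι (suc i)) ℚᵘ.* toℚᵘ (recip i)           ≈⟨ ℚᵘ.*-cong (toℚᵘ-ι (suc i)) (ℚ.toℚᵘ-fromℚᵘ (ℚᵘ.mkℚᵘ (ℤ.+ 1) i)) ⟩
  ℚᵘ.mkℚᵘ (ℤ.+ suc i) 0 ℚᵘ.* ℚᵘ.mkℚᵘ (ℤ.+ 1) i   ≈⟨ ℚᵘ.*-inverseʳ (ℚᵘ.mkℚᵘ (ℤ.+ suc i) 0) ⟩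
  ℚᵘ.1ℚᵘ                                         ∎)
  where open ℚᵘ.≃-Reasoning

recip-antitone : ∀ {i j} → i ℕ.≤ j → recip j ℚ.≤ recip i
recip-antitone {i} {j} i≤j = begin
  recip j                                 ≡⟨ ℚ.*-identityˡ (recip j) ⟨
  1ℚ ℚ.* recip j                          ≡⟨ ≡.cong (ℚ._* recip j) (ι*recip i) ⟨
  ι (suc i) ℚ.* recip i ℚ.* recip j       ≤⟨ *-monoʳ (0≤recip j) (*-monoʳ (0≤recip i) (ι-mono (s≤s i≤j))) ⟩
  ι (suc j) ℚ.* recip i ℚ.* recip j       ≡⟨ solve 3 (λ n a b → n :* a :* b := (n :* b) :* a) ≡.refl
                                               (ι (suc j)) (recip i) (recip j) ⟩
  ι (suc j) ℚ.* recip j ℚ.* recip i       ≡⟨ ≡.cong (ℚ._* recip i) (ι*recip j) ⟩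
  1ℚ ℚ.* recip i                          ≡⟨ ℚ.*-identityˡ (recip i) ⟩
  recip i                                 ∎
  where
  open ℚ.≤-Reasoning
  open ℚ.+-*-Solver

∑-mono : ∀ {a b} → (∀ i → a i ℚ.≤ b i) → ∀ n → ∑ a n ℚ.≤ ∑ b n
∑-mono a≤b zero    = ℚ.≤-refl
∑-mono a≤b (suc n) = ℚ.+-mono-≤ (∑-mono a≤b n) (a≤b n)

∑-increasing : ∀ {a} → (∀ i → 0ℚ ℚ.≤ a i) → ∀ {m n} → m ℕ.≤ n → ∑ a m ℚ.≤ ∑ a n
∑-increasing {a} 0≤a {m} {n} m≤n = ≡.subst (λ t → ∑ a m ℚ.≤ ∑ a t) (ℕ.m∸n+n≡m m≤n) (go (n ℕ.∸ m))
  where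
  go : ∀ d → ∑ a m ℚ.≤ ∑ a (d ℕ.+ m)
  go zero    = ℚ.≤-refl
  go (suc d) = ℚ.≤-trans (go d) (p≤p+q (0≤a (d ℕ.+ m)))

0≤∑ : ∀ {a} → (∀ i → 0ℚ ℚ.≤ a i) → ∀ n → 0ℚ ℚ.≤ ∑ a n
0≤∑ 0≤a n = ∑-increasing 0≤a (z≤n {n})

term≤∑ : ∀ {a} → (∀ i → 0ℚ ℚ.≤ a i) → ∀ {m n} → m ℕ.< n → a m ℚ.≤ ∑ a n
term≤∑ {a} 0≤a {m} m<n = ℚ.≤-trans
  (≡.subst (ℚ._≤ ∑ a m ℚ.+ a m) (ℚ.+-identityˡ (a m)) (ℚ.+-monoˡ-≤ (a m) (0≤∑ 0≤a m)))
  (∑-increasing 0≤a m<n)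

∑-block : ∀ {a w} d N → (∀ {i} → i ℕ.< d ℕ.+ N → w ℚ.≤ a i) → ∑ a N ℚ.+ ι d ℚ.* w ℚ.≤ ∑ a (d ℕ.+ N)
∑-block {a} {w} zero    N w≤a = ℚ.≤-reflexive
  (≡.trans (≡.cong (∑ a N ℚ.+_) (ℚ.*-zeroˡ w)) (ℚ.+-identityʳ (∑ a N)))
∑-block {a} {w} (suc d) N w≤a = begin
  ∑ a N ℚ.+ ι (suc d) ℚ.* w           ≡⟨ ≡.cong (λ t → ∑ a N ℚ.+ t ℚ.* w) (ι-+ 1 d) ⟩
  ∑ a N ℚ.+ (1ℚ ℚ.+ ι d) ℚ.* w        ≡⟨ solve 3 (λ s d w → s :+ (con 1ℚ :+ d) :* w := (s :+ d :* w) :+ w) ≡.refl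
                                           (∑ a N) (ι d) w ⟩
  ∑ a N ℚ.+ ι d ℚ.* w ℚ.+ w           ≤⟨ ℚ.+-mono-≤ (∑-block d N (λ i< → w≤a (ℕ.m<n⇒m<1+n i<))) (w≤a ℕ.≤-refl) ⟩
  ∑ a (d ℕ.+ N) ℚ.+ a (d ℕ.+ N)       ∎
  where
  open ℚ.≤-Reasoning
  open ℚ.+-*-Solver

-- Oresme's grouping: doubling the range from 2^m adds 2^m terms, each at least 1/2^(m+1), hence at
-- least 1/2 in all.
harmonic : ∀ m → ι (2 ℕ.+ m) ℚ.≤ ι 2 ℚ.* ∑ recip (2 ℕ.^ m)
harmonic zero    = ℚ.≤-reflexive ≡.refl
harmonic (suc m) = begin
  ι (3 ℕ.+ m)                                      ≡⟨ ≡.trans (≡.cong ι (ℕ.+-comm 1 (2 ℕ.+ m))) (ι-+ (2 ℕ.+ m) 1) ⟩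
  ι (2 ℕ.+ m) ℚ.+ 1ℚ                               ≤⟨ ℚ.+-monoˡ-≤ 1ℚ (harmonic m) ⟩
  ι 2 ℚ.* ∑ recip N ℚ.+ 1ℚ                         ≡⟨ ≡.cong (ι 2 ℚ.* ∑ recip N ℚ.+_) half ⟨
  ι 2 ℚ.* ∑ recip N ℚ.+ ι 2 ℚ.* (ι N ℚ.* w)        ≡⟨ ℚ.*-distribˡ-+ (ι 2) (∑ recip N) (ι N ℚ.* w) ⟨
  ι 2 ℚ.* (∑ recip N ℚ.+ ι N ℚ.* w)                ≤⟨ *-monoˡ (0≤ι 2) (∑-block N N λ i<N+N → recip-antitone
                                                        (ℕ.<⇒≤pred i<N+N)) ⟩
  ι 2 ℚ.* ∑ recip (N ℕ.+ N)                        ≡⟨ ≡.cong (λ t → ι 2 ℚ.* ∑ recip (N ℕ.+ t)) (ℕ.+-identityʳ N) ⟨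
  ι 2 ℚ.* ∑ recip (2 ℕ.^ suc m)                    ∎
  where
  open ℚ.≤-Reasoning
  N = 2 ℕ.^ m
  w = recip (ℕ.pred (N ℕ.+ N))
  instance
    N≢0 : ℕ.NonZero N
    N≢0 = ℕ.m^n≢0 2 m
    N+N≢0 : ℕ.NonZero (N ℕ.+ N)
    N+N≢0 = ℕ.>-nonZero (ℕ.<-≤-trans (ℕ.>-nonZero⁻¹ N) (ℕ.m≤m+n N N))
  half : ι 2 ℚ.* (ι N ℚ.* w) ≡ 1ℚ
  half = ≡.trans (≡.sym (ℚ.*-assoc (ι 2) (ι N) w)) (≡.trans (≡.cong (ℚ._* w) (≡.trans (≡.sym (ι-* 2 N))
    (≡.cong ι (≡.trans (≡.cong (N ℕ.+_) (ℕ.+-identityʳ N)) (≡.sym (ℕ.suc-pred (N ℕ.+ N)))))))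
    (ι*recip (ℕ.pred (N ℕ.+ N))))

module LnTerm (n : ℕ) where

  open ℚ.≤-Reasoning

  u y : ℚ
  u = recip n
  y = 1ℚ ℚ.- u

  u+y≡1 : u ℚ.+ y ≡ 1ℚ
  u+y≡1 = solve 1 (λ u → u :+ (con 1ℚ :- u) := con 1ℚ) ≡.refl u
    where open ℚ.+-*-Solver

  0≤y : 0ℚ ℚ.≤ y
  0≤y = +-cancelˡ-≤ u (≡.subst₂ ℚ._≤_ (≡.sym (ℚ.+-identityʳ u)) (≡.sym u+y≡1) (recip-antitone {0} {n} z≤n))

  0≤y^ : ∀ i → 0ℚ ℚ.≤ y ^ℚ i
  0≤y^ zero    = 0≤ι 1
  0≤y^ (suc i) = 0≤* 0≤y (0≤y^ i)

  0≤lnTerm : ∀ i → 0ℚ ℚ.≤ lnTerm n i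
  0≤lnTerm i = 0≤* (0≤y^ (suc i)) (0≤recip i)

  bernoulli : ∀ i → 1ℚ ℚ.≤ y ^ℚ i ℚ.+ ι i ℚ.* u
  bernoulli zero    = ℚ.≤-reflexive (≡.sym (≡.trans (≡.cong (1ℚ ℚ.+_) (ℚ.*-zeroˡ u)) (ℚ.+-identityʳ 1ℚ)))
  bernoulli (suc i) = begin
    1ℚ                                                  ≡⟨ u+y≡1 ⟨
    u ℚ.+ y                                             ≡⟨ ≡.cong (u ℚ.+_) (ℚ.*-identityʳ y) ⟨
    u ℚ.+ y ℚ.* 1ℚ                                      ≤⟨ ℚ.+-monoʳ-≤ u (*-monoˡ 0≤y (bernoulli i)) ⟩
    u ℚ.+ y ℚ.* (y ^ℚ i ℚ.+ ι i ℚ.* u)                   ≤⟨ p≤p+q (0≤* (0≤* (0≤recip n) (0≤ι i)) (0≤recip n)) ⟩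
    u ℚ.+ y ℚ.* (y ^ℚ i ℚ.+ ι i ℚ.* u) ℚ.+ u ℚ.* ι i ℚ.* u
      ≡⟨ solve 4 (λ u y z i → u :+ y :* (z :+ i :* u) :+ u :* i :* u :=
           y :* z :+ (u :+ (u :+ y) :* i :* u)) ≡.refl u y (y ^ℚ i) (ι i) ⟩
    y ℚ.* y ^ℚ i ℚ.+ (u ℚ.+ (u ℚ.+ y) ℚ.* ι i ℚ.* u)
      ≡⟨ ≡.cong (λ t → y ℚ.* y ^ℚ i ℚ.+ (u ℚ.+ t ℚ.* ι i ℚ.* u)) u+y≡1 ⟩
    y ℚ.* y ^ℚ i ℚ.+ (u ℚ.+ 1ℚ ℚ.* ι i ℚ.* u)
      ≡⟨ solve 3 (λ a u i → a :+ (u :+ con 1ℚ :* i :* u) := a :+ (con 1ℚ :+ i) :* u) ≡.refl (y ℚ.* y ^ℚ i) u (ι i) ⟩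
    y ℚ.* y ^ℚ i ℚ.+ (1ℚ ℚ.+ ι i) ℚ.* u                  ≡⟨ ≡.cong (λ t → y ℚ.* y ^ℚ i ℚ.+ t ℚ.* u) (ι-+ 1 i) ⟨
    y ^ℚ suc i ℚ.+ ι (suc i) ℚ.* u                       ∎
    where open ℚ.+-*-Solver

  recip≤lnTerm+u : ∀ i → recip i ℚ.≤ lnTerm n i ℚ.+ u
  recip≤lnTerm+u i = begin
    recip i                                                ≡⟨ ℚ.*-identityˡ (recip i) ⟨
    1ℚ ℚ.* recip i                                         ≤⟨ *-monoʳ (0≤recip i) (bernoulli (suc i)) ⟩
    (y ^ℚ suc i ℚ.+ ι (suc i) ℚ.* u) ℚ.* recip i
      ≡⟨ solve 4 (λ z n u v → (z :+ n :* u) :* v := z :* v :+ (n :* v) :* u) ≡.refl (y ^ℚ suc i) (ι (suc i)) u (recip i) ⟩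
    lnTerm n i ℚ.+ (ι (suc i) ℚ.* recip i) ℚ.* u           ≡⟨ ≡.cong (λ t → lnTerm n i ℚ.+ t ℚ.* u) (ι*recip i) ⟩
    lnTerm n i ℚ.+ 1ℚ ℚ.* u                                ≡⟨ ≡.cong (lnTerm n i ℚ.+_) (ℚ.*-identityˡ u) ⟩
    lnTerm n i ℚ.+ u                                       ∎
    where open ℚ.+-*-Solver

  ∑-+u : ∀ N → ∑ (λ i → lnTerm n i ℚ.+ u) N ≡ ∑ (lnTerm n) N ℚ.+ ι N ℚ.* u
  ∑-+u zero    = ≡.sym (≡.trans (ℚ.+-identityˡ _) (ℚ.*-zeroˡ u))
  ∑-+u (suc N) = ≡.trans (≡.cong (ℚ._+ (lnTerm n N ℚ.+ u)) (∑-+u N))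
    (≡.trans (solve 4 (λ s k u t → (s :+ k :* u) :+ (t :+ u) := (s :+ t) :+ (con 1ℚ :+ k) :* u) ≡.refl
      (∑ (lnTerm n) N) (ι N) u (lnTerm n N))
      (≡.cong (λ k → ∑ (lnTerm n) (suc N) ℚ.+ k ℚ.* u) (≡.sym (ι-+ 1 N))))
    where open ℚ.+-*-Solver

  -- By Bernoulli each Mercator term falls short of 1/(i+1) by at most u, so the first 2^m terms
  -- lose at most 1 against the harmonic sum. Doubled, this loss is covered by the surplus 2 in
  -- `harmonic`.
  log₂≤2*ln : ∀ {m N} → 2 ℕ.^ m ℕ.≤ suc n → 2 ℕ.^ m ℕ.≤ N → ι m ℚ.≤ ι 2 ℚ.* ∑ (lnTerm n) N
  log₂≤2*ln {m} {N} M≤1+n M≤N = ℚ.≤-trans (+-cancelˡ-≤ (ι 2) (begin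
    ι 2 ℚ.+ ι m                                            ≡⟨ ι-+ 2 m ⟨
    ι (2 ℕ.+ m)                                            ≤⟨ harmonic m ⟩
    ι 2 ℚ.* ∑ recip M                                      ≤⟨ *-monoˡ (0≤ι 2) (∑-mono recip≤lnTerm+u M) ⟩
    ι 2 ℚ.* ∑ (λ i → lnTerm n i ℚ.+ u) M                   ≡⟨ ≡.cong (ι 2 ℚ.*_) (∑-+u M) ⟩
    ι 2 ℚ.* (∑ (lnTerm n) M ℚ.+ ι M ℚ.* u)                 ≤⟨ *-monoˡ (0≤ι 2) (ℚ.+-monoʳ-≤ (∑ (lnTerm n) M) Mu≤1) ⟩
    ι 2 ℚ.* (∑ (lnTerm n) M ℚ.+ 1ℚ)                        ≡⟨ solve 2 (λ t s → t :* (s :+ con 1ℚ) := t :+ t :* s) ≡.refl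
                                                               (ι 2) (∑ (lnTerm n) M) ⟩
    ι 2 ℚ.+ ι 2 ℚ.* ∑ (lnTerm n) M                         ∎))
    (*-monoˡ (0≤ι 2) (∑-increasing 0≤lnTerm M≤N))
    where
    open ℚ.+-*-Solver
    M = 2 ℕ.^ m
    Mu≤1 : ι M ℚ.* u ℚ.≤ 1ℚ
    Mu≤1 = ≡.subst (ι M ℚ.* u ℚ.≤_) (ι*recip n) (*-monoʳ (0≤recip n) (ι-mono M≤1+n))

^-mono-base : ∀ {x y} → 0ℚ ℚ.≤ x → x ℚ.≤ y → ∀ i → x ^ℚ i ℚ.≤ y ^ℚ i × 0ℚ ℚ.≤ x ^ℚ i
^-mono-base 0≤x x≤y zero    = ℚ.≤-refl , 0≤ι 1
^-mono-base 0≤x x≤y (suc i) with ^-mono-base 0≤x x≤y i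
... | le , 0≤ = *-mono 0≤x 0≤ x≤y le , 0≤* 0≤x 0≤

lnTerm-mono : ∀ {m n} → m ℕ.≤ n → ∀ i → lnTerm m i ℚ.≤ lnTerm n i
lnTerm-mono {m} m≤n i = *-monoʳ (0≤recip i) (proj₁ (^-mono-base (LnTerm.0≤y m)
  (ℚ.+-monoʳ-≤ 1ℚ (ℚ.neg-antimono-≤ (recip-antitone m≤n))) (suc i)))

-- This is ln 3 > 1. For y = 2/3 four terms of the series give 28/27, while three give only 80/81; a
-- larger n increases y and with it every term.
1≤ln : ∀ {n N} → 2 ℕ.≤ n → 4 ℕ.≤ N → 1ℚ ℚ.≤ ∑ (lnTerm n) N
1≤ln {n} {N} 2≤n 4≤N = begin
  1ℚ                 ≤⟨ from-yes (1ℚ ℚ.≤? ∑ (lnTerm 2) 4) ⟩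
  ∑ (lnTerm 2) 4     ≤⟨ ∑-mono (lnTerm-mono 2≤n) 4 ⟩
  ∑ (lnTerm n) 4     ≤⟨ ∑-increasing (LnTerm.0≤lnTerm n) 4≤N ⟩
  ∑ (lnTerm n) N     ∎
  where open ℚ.≤-Reasoning

0≤expTerm : ∀ {x} → 0ℚ ℚ.≤ x → ∀ i → 0ℚ ℚ.≤ expTerm x i
0≤expTerm 0≤x zero    = 0≤ι 1
0≤expTerm 0≤x (suc i) = 0≤* (0≤expTerm 0≤x i) (0≤* 0≤x (0≤recip i))

expTerm-mono : ∀ {x y} → 0ℚ ℚ.≤ x → x ℚ.≤ y → ∀ i → expTerm x i ℚ.≤ expTerm y i
expTerm-mono 0≤x x≤y zero    = ℚ.≤-refl
expTerm-mono 0≤x x≤y (suc i) = *-mono (0≤expTerm 0≤x i) (0≤* 0≤x (0≤recip i))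
  (expTerm-mono 0≤x x≤y i) (*-monoʳ (0≤recip i) x≤y)

expTerm*! : ∀ m i → expTerm (ι m) i ℚ.* ι (i !) ≡ ι (m ℕ.^ i)
expTerm*! m zero    = ≡.refl
expTerm*! m (suc i) = begin
  expTerm (ι m) i ℚ.* (ι m ℚ.* recip i) ℚ.* ι (suc i ℕ.* i !)
    ≡⟨ ≡.cong (expTerm (ι m) i ℚ.* (ι m ℚ.* recip i) ℚ.*_) (ι-* (suc i) (i !)) ⟩
  expTerm (ι m) i ℚ.* (ι m ℚ.* recip i) ℚ.* (ι (suc i) ℚ.* ι (i !))
    ≡⟨ solve 5 (λ e m v s f → e :* (m :* v) :* (s :* f) := (s :* v) :* (m :* (e :* f))) ≡.refl
         (expTerm (ι m) i) (ι m) (recip i) (ι (suc i)) (ι (i !)) ⟩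
  ι (suc i) ℚ.* recip i ℚ.* (ι m ℚ.* (expTerm (ι m) i ℚ.* ι (i !)))
    ≡⟨ ≡.cong₂ (λ s t → s ℚ.* (ι m ℚ.* t)) (ι*recip i) (expTerm*! m i) ⟩
  1ℚ ℚ.* (ι m ℚ.* ι (m ℕ.^ i))
    ≡⟨ ℚ.*-identityˡ _ ⟩
  ι m ℚ.* ι (m ℕ.^ i)
    ≡⟨ ι-* m (m ℕ.^ i) ⟨
  ι (m ℕ.^ suc i) ∎
  where
  open ≡.≡-Reasoning
  open ℚ.+-*-Solver

-- Bernoulli's inequality (1 + 1/m)^j ≥ 1 + j/m with denominators cleared.
[m+j]m^j≤m[1+m]^j : ∀ m j → (m ℕ.+ j) ℕ.* m ℕ.^ j ℕ.≤ m ℕ.* suc m ℕ.^ j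
[m+j]m^j≤m[1+m]^j m zero    = ℕ.≤-reflexive (≡.cong (ℕ._* 1) (ℕ.+-identityʳ m))
[m+j]m^j≤m[1+m]^j m (suc j) = begin
  (m ℕ.+ suc j) ℕ.* (m ℕ.* a)
    ≤⟨ ℕ.m≤m+n _ (j ℕ.* a) ⟩
  (m ℕ.+ suc j) ℕ.* (m ℕ.* a) ℕ.+ j ℕ.* a
    ≡⟨ solve 3 (λ m j a → (m :+ (con 1 :+ j)) :* (m :* a) :+ j :* a :=
         (con 1 :+ m) :* ((m :+ j) :* a)) ≡.refl m j a ⟩
  suc m ℕ.* ((m ℕ.+ j) ℕ.* a)
    ≤⟨ ℕ.*-monoʳ-≤ (suc m) ([m+j]m^j≤m[1+m]^j m j) ⟩
  suc m ℕ.* (m ℕ.* suc m ℕ.^ j)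
    ≡⟨ solve 2 (λ m b → (con 1 :+ m) :* (m :* b) := m :* ((con 1 :+ m) :* b)) ≡.refl m (suc m ℕ.^ j) ⟩
  m ℕ.* suc m ℕ.^ suc j ∎
  where
  open ℕ.≤-Reasoning
  open ℕ.+-*-Solver
  a = m ℕ.^ j

2m^m≤[1+m]^m : ∀ m .{{_ : ℕ.NonZero m}} → 2 ℕ.* m ℕ.^ m ℕ.≤ suc m ℕ.^ m
2m^m≤[1+m]^m m = ℕ.*-cancelˡ-≤ m (begin
  m ℕ.* (2 ℕ.* m ℕ.^ m)        ≡⟨ solve 2 (λ m a → m :* (con 2 :* a) := (m :+ m) :* a) ≡.refl m (m ℕ.^ m) ⟩
  (m ℕ.+ m) ℕ.* m ℕ.^ m        ≤⟨ [m+j]m^j≤m[1+m]^j m m ⟩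
  m ℕ.* suc m ℕ.^ m            ∎)
  where
  open ℕ.≤-Reasoning
  open ℕ.+-*-Solver

-- From m to m + 1 the quotient m^m/m! grows by the factor (1 + 1/m)^m, at least 2 for m ≥ 1. From 0
-- to 1 it does not grow, which the 2 on the right pays for.
2^m*m!≤2*m^m : ∀ m → 2 ℕ.^ m ℕ.* m ! ℕ.≤ 2 ℕ.* m ℕ.^ m
2^m*m!≤2*m^m zero          = s≤s z≤n
2^m*m!≤2*m^m (suc zero)    = ℕ.≤-refl
2^m*m!≤2*m^m (suc m@(suc _)) = begin
  2 ℕ.* 2 ℕ.^ m ℕ.* (suc m ℕ.* m !)
    ≡⟨ solve 3 (λ a s f → con 2 :* a :* (s :* f) := con 2 :* s :* (a :* f)) ≡.refl (2 ℕ.^ m) (suc m) (m !) ⟩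
  2 ℕ.* suc m ℕ.* (2 ℕ.^ m ℕ.* m !)
    ≤⟨ ℕ.*-monoʳ-≤ (2 ℕ.* suc m) (ℕ.≤-trans (2^m*m!≤2*m^m m) (2m^m≤[1+m]^m m)) ⟩
  2 ℕ.* suc m ℕ.* suc m ℕ.^ m
    ≡⟨ ℕ.*-assoc 2 (suc m) (suc m ℕ.^ m) ⟩
  2 ℕ.* suc m ℕ.^ suc m ∎
  where
  open ℕ.≤-Reasoning
  open ℕ.+-*-Solver

2^m≤2*expTerm : ∀ m → ι (2 ℕ.^ m) ℚ.≤ ι 2 ℚ.* expTerm (ι m) m
2^m≤2*expTerm m = ℚ.*-cancelʳ-≤-pos (ι (m !)) {{ι-pos (m !) {{m ℕ.!≢0}}}} (begin
  ι (2 ℕ.^ m) ℚ.* ι (m !)                      ≡⟨ ι-* (2 ℕ.^ m) (m !) ⟨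
  ι (2 ℕ.^ m ℕ.* m !)                          ≤⟨ ι-mono (2^m*m!≤2*m^m m) ⟩
  ι (2 ℕ.* m ℕ.^ m)                            ≡⟨ ι-* 2 (m ℕ.^ m) ⟩
  ι 2 ℚ.* ι (m ℕ.^ m)                          ≡⟨ ≡.cong (ι 2 ℚ.*_) (expTerm*! m m) ⟨
  ι 2 ℚ.* (expTerm (ι m) m ℚ.* ι (m !))        ≡⟨ ℚ.*-assoc (ι 2) (expTerm (ι m) m) (ι (m !)) ⟨
  ι 2 ℚ.* expTerm (ι m) m ℚ.* ι (m !)          ∎)
  where open ℚ.≤-Reasoning

dyadic : ∀ r → ∃[ m ] 2 ℕ.^ m ℕ.≤ suc r × suc r ℕ.< 2 ℕ.^ suc m
dyadic zero    = 0 , ℕ.≤-refl , ℕ.≤-refl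
dyadic (suc r) with dyadic r
... | m , lo , hi with suc (suc r) ℕ.<? 2 ℕ.^ suc m
...   | yes lt = m , ℕ.m≤n⇒m≤1+n lo , lt
...   | no ≮   = suc m , ℕ.≤-reflexive (≡.sym eq) ,
  ≡.subst (ℕ._< 2 ℕ.^ suc (suc m)) (≡.sym eq) (ℕ.^-monoʳ-< 2 (s≤s (s≤s z≤n)) (ℕ.n<1+n (suc m)))
  where eq = ℕ.≤-antisym hi (ℕ.≮⇒≥ ≮)

-- Since 2 ln r ≥ log₂ r up to rounding, already the single term of index
-- m = ⌊log₂ r⌋ of the exponential series gives exp (x ln r) ≥ mᵐ / m! ≥ 2ᵐ⁻¹.
linear≤power : ∀ c (x : ℝ) N₀ → (∀ n → N₀ ℕ.≤ n → ι 2 ℚ.≤ seq x n) →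
  ∀ r → 1 ℕ.≤ r → fromℕ (c ℕ.* r) ≤ᵣ fromℕ (4 ℕ.* c) *ᵣ r ^ᵣ x
linear≤power c x N₀ 2≤x (suc r) _ δ 0<δ = N , λ n N≤n → begin
  ι (c ℕ.* suc r)
    ≤⟨ ι-mono (ℕ.*-monoʳ-≤ c (ℕ.<⇒≤ (proj₂ (proj₂ (dyadic r))))) ⟩
  ι (c ℕ.* (2 ℕ.* 2 ℕ.^ m))
    ≡⟨ ≡.trans (ι-* c (2 ℕ.* 2 ℕ.^ m)) (≡.cong (ι c ℚ.*_) (ι-* 2 (2 ℕ.^ m))) ⟩
  ι c ℚ.* (ι 2 ℚ.* ι (2 ℕ.^ m))
    ≤⟨ *-monoˡ (0≤ι c) (*-monoˡ (0≤ι 2) (2^m≤2*expTerm m)) ⟩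
  ι c ℚ.* (ι 2 ℚ.* (ι 2 ℚ.* expTerm (ι m) m))
    ≡⟨ solve 3 (λ c t e → c :* (t :* (t :* e)) := (t :* t) :* c :* e) ≡.refl (ι c) (ι 2) (expTerm (ι m) m) ⟩
  ι 4 ℚ.* ι c ℚ.* expTerm (ι m) m
    ≡⟨ ≡.cong (ℚ._* expTerm (ι m) m) (ι-* 4 c) ⟨
  ι (4 ℕ.* c) ℚ.* expTerm (ι m) m
    ≤⟨ *-monoˡ (0≤ι (4 ℕ.* c)) (bound n N≤n) ⟩
  ι (4 ℕ.* c) ℚ.* ∑ (expTerm (seq x n ℚ.* ∑ (lnTerm r) n)) n
    ≤⟨ p≤p+q (ℚ.<⇒≤ 0<δ) ⟩
  ι (4 ℕ.* c) ℚ.* ∑ (expTerm (seq x n ℚ.* ∑ (lnTerm r) n)) n ℚ.+ δ ∎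
  where
  open ℚ.≤-Reasoning
  open ℚ.+-*-Solver
  m = proj₁ (dyadic r)
  -- Past this index the exponent is at least 2, the logarithm has its first 2^m terms, and the
  -- exponential sum contains the term of index m.
  N = N₀ ℕ.⊔ (2 ℕ.^ m ℕ.⊔ suc m)
  bound : ∀ n → N ℕ.≤ n → expTerm (ι m) m ℚ.≤ ∑ (expTerm (seq x n ℚ.* ∑ (lnTerm r) n)) n
  bound n N≤n = ℚ.≤-trans (expTerm-mono (0≤ι m) m≤y m) (term≤∑ (0≤expTerm (ℚ.≤-trans (0≤ι m) m≤y)) m<n)
    where
    N₀≤n = ℕ.m⊔n≤o⇒m≤o N₀ _ N≤n
    rest = ℕ.m⊔n≤o⇒n≤o N₀ _ N≤n
    m<n = ℕ.m⊔n≤o⇒n≤o (2 ℕ.^ m) (suc m) rest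
    m≤y : ι m ℚ.≤ seq x n ℚ.* ∑ (lnTerm r) n
    -- The lower bound 2 on the exponent matches the factor 2 in `log₂≤2*ln`.
    m≤y = ℚ.≤-trans
      (LnTerm.log₂≤2*ln r {m} (proj₁ (proj₂ (dyadic r))) (ℕ.m⊔n≤o⇒m≤o (2 ℕ.^ m) (suc m) rest))
      (*-monoʳ (0≤∑ (LnTerm.0≤lnTerm r) n) (2≤x n N₀≤n))

-- Bounds for the Waring numbers

open import Data.Nat.Base using (_^_; _∸_; _>_)

module _ {c ℓ₁ ℓ₂} (em : ExcludedMiddle (c ⊔ ℓ₁)) (F : HeytingField c ℓ₁ ℓ₂) where

  open HeytingField F

  private module R = CommutativeRing (fieldRing F)

  -- A Heyting field inverts what is apart from zero. An element without inverse is therefore not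
  -- apart from zero, and tightness makes it equal to zero.
  field-inverse : PolynomialProperties.HasInverses (fieldRing F)
  field-inverse x x≉0 with em {∃[ y ] y * x ≈ 1#}
  ... | yes inv = inv
  ... | no none = contradiction (proj₁ (tight x 0#) λ x#0 →
    let y , yx≈1 , _ = #⇒invertible x#0 in
    none (y , R.trans (R.*-congˡ (R.sym x-0≈x)) yx≈1)) x≉0
    where
    open import Algebra.Properties.Ring R.ring using (-0#≈0#)
    x-0≈x : x + - 0# ≈ x
    x-0≈x = R.trans (R.+-congˡ -0#≈0#) (R.+-identityʳ x)

  module _ (closed : AlgebraicallyClosed F) {p} (pr : Prime p) (char : HasCharacteristic F p) where

    1≉0 : ¬ 1# ≈ 0#
    1≉0 1≈0 = ¬prime[1] (≡.subst Prime
      (∣1⇒≡1 (Equivalence.to (char 1) (R.trans (R.+-identityʳ 1#) 1≈0))) pr)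

    suffices : ∀ r → 1 ℕ.≤ r → Suffices F (p ^ r ∸ 1) (4 ℕ.* p ℕ.* r)
    suffices r 1≤r f = proj₁ powers , ℕ.≤-trans (proj₁ (proj₂ powers)) 4N≤4pr , proj₂ (proj₂ powers)
      where
      powers = Representation.sum-of-powers (fieldRing F) closed field-inverse 1≉0 pr
        (Equivalence.from (char p) ∣-refl) {r} 1≤r f
      N = r ℕ.* ℕ.pred p ℕ.+ 1
      N≤rp : N ℕ.≤ r ℕ.* p
      N≤rp = begin
        r ℕ.* ℕ.pred p ℕ.+ 1          ≤⟨ ℕ.+-monoʳ-≤ (r ℕ.* ℕ.pred p) 1≤r ⟩
        r ℕ.* ℕ.pred p ℕ.+ r          ≡⟨ ℕ.+-comm _ r ⟩
        r ℕ.+ r ℕ.* ℕ.pred p          ≡⟨ ℕ.*-suc r (ℕ.pred p) ⟨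
        r ℕ.* suc (ℕ.pred p)          ≡⟨ ≡.cong (r ℕ.*_) (ℕ.suc-pred p {{prime⇒nonZero pr}}) ⟩
        r ℕ.* p                       ∎
        where open ℕ.≤-Reasoning
      4N≤4pr : N ℕ.+ (N ℕ.+ (N ℕ.+ N)) ℕ.≤ 4 ℕ.* p ℕ.* r
      4N≤4pr = begin
        N ℕ.+ (N ℕ.+ (N ℕ.+ N))            ≡⟨ ≡.cong (λ t → N ℕ.+ (N ℕ.+ (N ℕ.+ t))) (ℕ.+-identityʳ N) ⟨
        4 ℕ.* N                            ≤⟨ ℕ.*-monoʳ-≤ 4 N≤rp ⟩
        4 ℕ.* (r ℕ.* p)                    ≡⟨ ≡.cong (4 ℕ.*_) (ℕ.*-comm r p) ⟩
        4 ℕ.* (p ℕ.* r)                    ≡⟨ ℕ.*-assoc 4 p r ⟨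
        4 ℕ.* p ℕ.* r                      ∎
        where open ℕ.≤-Reasoning

    waringNumber≤ : ∀ {k s x} v → IsWaringNumber F k v → Suffices F k s → fromℕ s ≤ᵣ x → v ≤∞ x
    waringNumber≤ ∞       none           ok _   = none _ ok
    waringNumber≤ {s = s} (fin v) (_ , least) ok s≤x δ 0<δ with s≤x δ 0<δ
    ... | N , bound = N , λ n N≤n → ℚ.≤-trans (ι-mono (least s ok)) (bound n N≤n)

    v≤power : ∀ (x : ℝ) N₀ → (∀ n → N₀ ℕ.≤ n → ι 2 ℚ.≤ seq x n) →
      (λ r → v em F (p ^ r ∸ 1)) =O (λ r → r ^ᵣ x)
    -- There are at most 4 p r summands, and `linear≤power` costs another factor 4. The range starts
    -- at r = 1, where k becomes positive.
    v≤power x N₀ 2≤x = fromℕ (4 ℕ.* (4 ℕ.* p)) , 1 , λ r 1≤r →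
      waringNumber≤ (v em F (p ^ r ∸ 1)) (proj₂ (waringNumber em F (p ^ r ∸ 1)))
        (suffices r 1≤r) (linear≤power (4 ℕ.* p) x N₀ 2≤x r 1≤r)

theorem4 : ∀ {c ℓ₁ ℓ₂} (em : ExcludedMiddle (c ⊔ ℓ₁)) (p : ℕ) → Prime p →
    (F : HeytingField c ℓ₁ ℓ₂) → AlgebraicallyClosed F → HasCharacteristic F p →
    (ε : ℝ) → fromℕ 0 <ᵣ ε →
    (p > 2 → (λ r → v em F (p ^ r ∸ 1)) =O (λ r → r ^ᵣ ((fromℕ 2 +ᵣ ε) *ᵣ ln p))) ×
    (p ≡ 2 → (λ r → v em F (p ^ r ∸ 1)) =O (λ r → r ^ᵣ (fromℕ 2 +ᵣ ε)))
theorem4 em p pr F closed char ε (δ , 0<δ , N , δ≤ε) =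
  -- Beyond N the approximations of ε are positive, and 4 is the number of terms after which those
  -- of ln p reach 1.
  (λ p>2 → v≤power em F closed pr char ((fromℕ 2 +ᵣ ε) *ᵣ ln p) (N ℕ.⊔ 4) (2≤[2+ε]*ln p p>2)) ,
  (λ _   → v≤power em F closed pr char (fromℕ 2 +ᵣ ε) N 2≤2+ε)
  where
  2≤2+ε : ∀ n → N ℕ.≤ n → ι 2 ℚ.≤ ι 2 ℚ.+ seq ε n
  2≤2+ε n N≤n = p≤p+q (ℚ.≤-trans (ℚ.≤-trans (ℚ.<⇒≤ 0<δ)
    (ℚ.≤-reflexive (≡.sym (ℚ.+-identityˡ δ)))) (δ≤ε n N≤n))

  2≤[2+ε]*ln : ∀ q → q > 2 → ∀ n → N ℕ.⊔ 4 ℕ.≤ n →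
    ι 2 ℚ.≤ seq ((fromℕ 2 +ᵣ ε) *ᵣ ln q) n
  2≤[2+ε]*ln (suc q) (s≤s 2≤q) n N⊔4≤n = ℚ.≤-trans (ℚ.≤-reflexive (≡.sym (ℚ.*-identityʳ (ι 2))))
    (*-mono (0≤ι 2) (0≤ι 1) (2≤2+ε n (ℕ.m⊔n≤o⇒m≤o N 4 N⊔4≤n)) (1≤ln 2≤q (ℕ.m⊔n≤o⇒n≤o N 4 N⊔4≤n)))
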